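{- Let $r,s$ be coprime positive integers with $2\mid s$ and $1\le s<r/2$. Let $\Delta_1=s(r-s)(r+s)$ and define $p_{3,s}(n)$ by $$\sum_{n=0}^\infty p_{3,s}(n)q^n=\frac{1}{(1-q^s)(1-q^{r-s})(1-q^{r+s})}.$$ Then for all integers $n\ge 0$, $$P_{2,s}(n)+C^{d}_{3,s}\ \le\ p_{3,s}(n)\ \le\ P_{2,s}(n)+C^{u}_{3,s},$$ where $$\begin{aligned} P_{2,s}(n)&=\frac{1}{2\Delta_1}\left(n^2+2nr+ns+2r+s-1\right),\\ C^{u}_{3,s}&=\frac{1}{2\Delta_1}\Big(r^3(2s^2-s)+r^2(2s-2s^3)+r(-2s^4+s^3-2s-1)+2s^5-2s^3+2s^2-s+1\Big),\\ C^{d}_{3,s}&=\frac{1}{2\Delta_1}\Big(r^3(-2s^2-s)+2r^2s^3+r(2s^4+s^3+2s-1)-2s^5-2s^2-s+1\Big). \end{aligned}$$ -}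

module Defs where

open import Data.Nat.Base as ℕ using (ℕ; NonZero; _∸_)
import Data.Nat.Properties as ℕ
open import Data.Bool.Base using (if_then_else_)
open import Data.Fin.Base using (toℕ)
open import Data.Integer.Base using (ℤ; +_; 0ℤ; 1ℤ; -_; _+_; _-_; _*_; _^_)
import Data.Integer.Properties as ℤ
open import Data.Rational.Base using (ℚ; _/_)
open import Relation.Binary.PropositionalEquality.Core using (_≗_)

open import Algebra.Properties.Semiring.Sum ℤ.+-*-semiring using (sum⁺-syntax)

-- Formal power series over ℤ: f stands for Σₙ f(n) qⁿ.
Series : Set
Series = ℕ → ℤ

infix  8 1-q^_
infixl 7 _⊛_

1ₛ : Series
1ₛ n = if n ℕ.≡ᵇ 0 then 1ℤ else 0ℤ

q^_ : ℕ → Series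
(q^ k) n = if n ℕ.≡ᵇ k then 1ℤ else 0ℤ

1-q^_ : ℕ → Series
(1-q^ k) n = 1ₛ n - (q^ k) n

_⊛_ : Series → Series → Series
(f ⊛ g) n = ∑[ i ≤ n ] (f (toℕ i) * g (n ∸ toℕ i))

-- g = 1 / f in ℤ[[q]].  If f(0) = 1, there is exactly one such g up to ≗.
_IsReciprocalOf_ : Series → Series → Set
g IsReciprocalOf f = f ⊛ g ≗ 1ₛ

-- p = p₃,ₛ.  The truncated subtraction here and in Δ₁ is only used with s < r.
IsP₃ : (r s : ℕ) → Series → Set
IsP₃ r s p = p IsReciprocalOf ((1-q^ s) ⊛ (1-q^ (r ∸ s)) ⊛ (1-q^ (r ℕ.+ s)))

Δ₁ : (r s : ℕ) → ℕ
Δ₁ r s = s ℕ.* (r ∸ s) ℕ.* (r ℕ.+ s)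

2Δ₁-nonZero : ∀ {r s} → 1 ℕ.≤ s → 2 ℕ.* s ℕ.< r → NonZero (2 ℕ.* Δ₁ r s)
2Δ₁-nonZero {r} {s} 1≤s 2s<r = ℕ.m*n≢0 2 (Δ₁ r s)
  where
  s<r : s ℕ.< r
  s<r = ℕ.≤-<-trans (ℕ.m≤n*m s 2) 2s<r

  instance
    s≢0 : NonZero s
    s≢0 = ℕ.>-nonZero 1≤s

    r∸s≢0 : NonZero (r ∸ s)
    r∸s≢0 = ℕ.>-nonZero (ℕ.m<n⇒0<n∸m s<r)

    r+s≢0 : NonZero (r ℕ.+ s)
    r+s≢0 = ℕ.>-nonZero (ℕ.<-≤-trans 1≤s (ℕ.m≤n+m s r))

    s[r∸s]≢0 : NonZero (s ℕ.* (r ∸ s))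
    s[r∸s]≢0 = ℕ.m*n≢0 s (r ∸ s)

    Δ₁≢0 : NonZero (Δ₁ r s)
    Δ₁≢0 = ℕ.m*n≢0 (s ℕ.* (r ∸ s)) (r ℕ.+ s)

module _ (r′ s′ : ℕ) .{{_ : NonZero (2 ℕ.* Δ₁ r′ s′)}} where

  private
    r s : ℤ
    r = + r′
    s = + s′

  P₂ : ℕ → ℚ
  P₂ n′ = (n ^ 2 + + 2 * n * r + n * s + + 2 * r + s - 1ℤ) / (2 ℕ.* Δ₁ r′ s′)
    where
    n : ℤ
    n = + n′

  Cᵘ : ℚ
  Cᵘ = ( r ^ 3 * (+ 2 * s ^ 2 - s)
       + r ^ 2 * (+ 2 * s - + 2 * s ^ 3)
       + r * (- (+ 2 * s ^ 4) + s ^ 3 - + 2 * s - 1ℤ)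
       + + 2 * s ^ 5 - + 2 * s ^ 3 + + 2 * s ^ 2 - s + 1ℤ
       ) / (2 ℕ.* Δ₁ r′ s′)

  Cᵈ : ℚ
  Cᵈ = ( r ^ 3 * (- (+ 2 * s ^ 2) - s)
       + + 2 * r ^ 2 * s ^ 3
       + r * (+ 2 * s ^ 4 + s ^ 3 + + 2 * s - 1ℤ)
       - + 2 * s ^ 5 - + 2 * s ^ 2 - s + 1ℤ
       ) / (2 ℕ.* Δ₁ r′ s′)

{-# OPTIONS --safe #-}

-- Put a = s, b = r − s, c = r + s and Δ₁ = abc.  Since b ≡ c ≡ r (mod s), every solution of
-- a x + b y + c z = n has y + z = t + s k for a fixed t, and counting the solutions with given k gives
--   p(n) = Σ_{0 ≤ k ≤ w/c} (t + 1 + s k) + Σ_{w/c < k ≤ v/b} (⌊(v − b k)/2⌋ + 1),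
-- where n = r t + s u, v = u + t and w = u − t.  As b is odd, the floors alternate between being exact
-- and losing 1/2, and with α = w mod c and β = v mod b the sum becomes
--   8Δ₁ p(n) = 4n(n + a + b + c) + 8Δ₁ + 4bc t(s − 2 − t) + 2sc β(b − 3 − β) − 2sb α(c + 1 − α)
--              + Δ₁((−1)^β − (−1)^α).
-- The right-hand side is a quadratic polynomial in n plus functions of period a, b and c, so its
-- iterated difference with steps a, b, c vanishes.  Hence it agrees with 8Δ₁ p(n) as soon as it
-- vanishes for −(a + b + c) < n < 0 and equals 8Δ₁ at n = 0.  Bounding the periodic terms crudely
-- leaves polynomial inequalities in r and s.
module Submission where

open import Defs
open import Data.Empty using (⊥; ⊥-elim)
open import Data.Integer.Base
  using (ℤ; +_; +[1+_]; -[1+_]; 0ℤ; 1ℤ; -1ℤ; -_; _+_; _-_; _*_; _^_; _≤_; +≤+; -≤+)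
import Data.Integer.Properties as ℤ
open import Data.Integer.Tactic.RingSolver using (solve-∀; solve)
open import Data.List.Base using ([]; _∷_)
open import Data.Nat.Base as ℕ using (ℕ; zero; suc; NonZero)
open import Data.Nat.Coprimality using (Coprime; coprime-Bézout)
open import Data.Nat.Divisibility using (_∣_; divides; ∣m+n∣m⇒∣n; ∣n⇒∣m*n; ∣m∣n⇒∣m+n)
import Data.Nat.DivMod as ℕ
import Data.Nat.GCD as GCD
import Data.Nat.Properties as ℕ
import Data.Nat.Tactic.RingSolver as ℕ-Solver
open import Data.Product.Base using (_×_; _,_; ∃)
open import Data.Rational.Base as ℚ using (toℚᵘ; fromℚᵘ)
import Data.Rational.Properties as ℚ
open import Data.Rational.Unnormalised.Base as ℚᵘ using (mkℚᵘ)
import Data.Rational.Unnormalised.Properties as ℚᵘ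
open import Data.Sum.Base using (_⊎_; inj₁; inj₂)
open import Relation.Binary.PropositionalEquality
open import Relation.Nullary using (yes; no)

-- Multiplication by 1 − qᵉ

infixl 6 _⊖_
_⊖_ : Series → Series → Series
(f ⊖ g) n = f n - g n

shift : ℕ → Series → Series
shift zero    f n       = f n
shift (suc e) f zero    = 0ℤ
shift (suc e) f (suc n) = shift e f n

shift-cong : ∀ e {f g} → f ≗ g → shift e f ≗ shift e g
shift-cong zero    f≗g n       = f≗g n
shift-cong (suc e) f≗g zero    = refl
shift-cong (suc e) f≗g (suc n) = shift-cong e f≗g n

shift-⊖ : ∀ e f g → shift e (f ⊖ g) ≗ shift e f ⊖ shift e g
shift-⊖ zero    f g n       = refl
shift-⊖ (suc e) f g zero    = refl
shift-⊖ (suc e) f g (suc n) = shift-⊖ e f g n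

shift-shift : ∀ d e f → shift d (shift e f) ≗ shift (d ℕ.+ e) f
shift-shift zero    e f n       = refl
shift-shift (suc d) e f zero    = refl
shift-shift (suc d) e f (suc n) = shift-shift d e f n

shift-+ : ∀ d e f k → shift (d ℕ.+ e) f (d ℕ.+ k) ≡ shift e f k
shift-+ zero    e f k = refl
shift-+ (suc d) e f k = shift-+ d e f k

shift-< : ∀ {e k} f → k ℕ.< e → shift e f k ≡ 0ℤ
shift-< {suc e} {zero}  f _           = refl
shift-< {suc e} {suc k} f (ℕ.s≤s k<e) = shift-< f k<e

q^≗shift : ∀ e → q^ e ≗ shift e 1ₛ
q^≗shift zero    n       = refl
q^≗shift (suc e) zero    = refl
q^≗shift (suc e) (suc n) = q^≗shift e n

⊛-congˡ : ∀ {f g} h → f ≗ g → f ⊛ h ≗ g ⊛ h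
⊛-congˡ h f≗g zero    = cong (λ x → x * h 0 + 0ℤ) (f≗g 0)
⊛-congˡ h f≗g (suc n) = cong₂ (λ x y → x * h (suc n) + y) (f≗g 0) (⊛-congˡ h (λ i → f≗g (suc i)) n)

⊛-congʳ : ∀ f {g h} → g ≗ h → f ⊛ g ≗ f ⊛ h
⊛-congʳ f g≗h zero    = cong (λ x → f 0 * x + 0ℤ) (g≗h 0)
⊛-congʳ f g≗h (suc n) = cong₂ (λ x y → f 0 * x + y) (g≗h (suc n)) (⊛-congʳ (λ i → f (suc i)) g≗h n)

⊖-⊛-step : ∀ x y z u v → (x - y) * z + (u - v) ≡ (x * z + u) - (y * z + v)
⊖-⊛-step = solve-∀

⊖-⊛ : ∀ f g h → (f ⊖ g) ⊛ h ≗ (f ⊛ h) ⊖ (g ⊛ h)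
⊖-⊛ f g h zero    = ⊖-⊛-step (f 0) (g 0) (h 0) 0ℤ 0ℤ
⊖-⊛ f g h (suc n) = trans
  (cong (_+_ ((f 0 - g 0) * h (suc n))) (⊖-⊛ (λ i → f (suc i)) (λ i → g (suc i)) h n))
  (⊖-⊛-step (f 0) (g 0) (h (suc n)) _ _)

⊛-⊖-step : ∀ x y z u v → x * (y - z) + (u - v) ≡ (x * y + u) - (x * z + v)
⊛-⊖-step = solve-∀

⊛-⊖ : ∀ f g h → f ⊛ (g ⊖ h) ≗ (f ⊛ g) ⊖ (f ⊛ h)
⊛-⊖ f g h zero    = ⊛-⊖-step (f 0) (g 0) (h 0) 0ℤ 0ℤ
⊛-⊖ f g h (suc n) = trans
  (cong (_+_ (f 0 * (g (suc n) - h (suc n)))) (⊛-⊖ (λ i → f (suc i)) g h n))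
  (⊛-⊖-step (f 0) (g (suc n)) (h (suc n)) _ _)

shift-⊛ : ∀ e f g → shift e f ⊛ g ≗ shift e (f ⊛ g)
shift-⊛ zero    f g n       = refl
shift-⊛ (suc e) f g zero    = refl
shift-⊛ (suc e) f g (suc n) = trans (ℤ.+-identityˡ _) (shift-⊛ e f g n)

0⊛ : ∀ g n → ((λ _ → 0ℤ) ⊛ g) n ≡ 0ℤ
0⊛ g zero    = refl
0⊛ g (suc n) = trans (ℤ.+-identityˡ _) (0⊛ g n)

1ₛ⊛ : ∀ g → 1ₛ ⊛ g ≗ g
1ₛ⊛ g zero    = trans (ℤ.+-identityʳ _) (ℤ.*-identityˡ _)
1ₛ⊛ g (suc n) = trans (cong₂ _+_ (ℤ.*-identityˡ (g (suc n))) (0⊛ g n)) (ℤ.+-identityʳ (g (suc n)))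

⊛-shift1ₛ : ∀ f e → f ⊛ shift e 1ₛ ≗ shift e f
⊛-shift1ₛ f zero zero = trans (ℤ.+-identityʳ _) (ℤ.*-identityʳ _)
⊛-shift1ₛ f zero (suc n) = trans
  (cong₂ _+_ (ℤ.*-zeroʳ (f 0)) (⊛-shift1ₛ (λ i → f (suc i)) zero n)) (ℤ.+-identityˡ _)
⊛-shift1ₛ f (suc e) zero = trans (ℤ.+-identityʳ _) (ℤ.*-zeroʳ (f 0))
⊛-shift1ₛ f (suc e) (suc n) = trans
  (cong (_+_ (f 0 * shift e 1ₛ n)) (⊛-shift1ₛ (λ i → f (suc i)) (suc e) n))
  (unfold e n)
  where
  unfold : ∀ e n → f 0 * shift e 1ₛ n + shift (suc e) (λ i → f (suc i)) n ≡ shift e f n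
  unfold zero    zero    = trans (ℤ.+-identityʳ _) (ℤ.*-identityʳ _)
  unfold zero    (suc n) = trans (cong (_+ f (suc n)) (ℤ.*-zeroʳ (f 0))) (ℤ.+-identityˡ _)
  unfold (suc e) zero    = cong (_+ 0ℤ) (ℤ.*-zeroʳ (f 0))
  unfold (suc e) (suc n) = unfold e n

⊛-1-q^ : ∀ f e → f ⊛ (1-q^ e) ≗ f ⊖ shift e f
⊛-1-q^ f e n = begin
  (f ⊛ (1-q^ e)) n                    ≡⟨ ⊛-⊖ f 1ₛ (q^ e) n ⟩
  (f ⊛ 1ₛ) n - (f ⊛ (q^ e)) n         ≡⟨ cong₂ _-_ (⊛-shift1ₛ f 0 n) (⊛-congʳ f (q^≗shift e) n) ⟩
  f n - (f ⊛ shift e 1ₛ) n            ≡⟨ cong (_-_ (f n)) (⊛-shift1ₛ f e n) ⟩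
  f n - shift e f n                   ∎
  where open ≡-Reasoning

1-q^-⊛ : ∀ e g → (1-q^ e) ⊛ g ≗ g ⊖ shift e g
1-q^-⊛ e g n = begin
  ((1-q^ e) ⊛ g) n                    ≡⟨ ⊖-⊛ 1ₛ (q^ e) g n ⟩
  (1ₛ ⊛ g) n - ((q^ e) ⊛ g) n         ≡⟨ cong₂ _-_ (1ₛ⊛ g n) (⊛-congˡ g (q^≗shift e) n) ⟩
  g n - (shift e 1ₛ ⊛ g) n            ≡⟨ cong (_-_ (g n)) (trans (shift-⊛ e 1ₛ g n) (shift-cong e (1ₛ⊛ g) n)) ⟩
  g n - shift e g n                   ∎
  where open ≡-Reasoning

⊛-1-q^-⊛ : ∀ f e g → (f ⊛ (1-q^ e)) ⊛ g ≗ (f ⊛ g) ⊖ shift e (f ⊛ g)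
⊛-1-q^-⊛ f e g n = begin
  ((f ⊛ (1-q^ e)) ⊛ g) n              ≡⟨ ⊛-congˡ g (⊛-1-q^ f e) n ⟩
  ((f ⊖ shift e f) ⊛ g) n             ≡⟨ ⊖-⊛ f (shift e f) g n ⟩
  (f ⊛ g) n - (shift e f ⊛ g) n       ≡⟨ cong (_-_ ((f ⊛ g) n)) (shift-⊛ e f g n) ⟩
  (f ⊛ g) n - shift e (f ⊛ g) n       ∎
  where open ≡-Reasoning

⊖-cong-shift : ∀ e {f g} → f ≗ g → f ⊖ shift e f ≗ g ⊖ shift e g
⊖-cong-shift e f≗g n = cong₂ _-_ (f≗g n) (shift-cong e f≗g n)

triple : ℕ → ℕ → ℕ → Series → Series
triple a b c f = let g = f ⊖ shift a f ; h = g ⊖ shift b g in h ⊖ shift c h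

⊛-triple : ∀ a b c f → ((1-q^ a) ⊛ (1-q^ b) ⊛ (1-q^ c)) ⊛ f ≗ triple a b c f
⊛-triple a b c f n = trans
  (⊛-1-q^-⊛ ((1-q^ a) ⊛ (1-q^ b)) c f n)
  (⊖-cong-shift c (λ m → trans (⊛-1-q^-⊛ (1-q^ a) b f m) (⊖-cong-shift b (1-q^-⊛ a f) m)) n)

-- Vanishing of the formula for −σ < n < 0

infixl 6 _⊕_ _⊞_
infixl 7 _⊗_ _⊠_

0≤+ : ∀ n → 0ℤ ≤ + n
0≤+ n = +≤+ ℕ.z≤n

_⊕_ : ∀ {i j} → 0ℤ ≤ i → 0ℤ ≤ j → 0ℤ ≤ i + j
_⊕_ = ℤ.+-mono-≤

_⊗_ : ∀ {i j} → 0ℤ ≤ i → 0ℤ ≤ j → 0ℤ ≤ i * j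
_⊗_ {+ m} {+ n} _ _ = subst (0ℤ ≤_) (ℤ.pos-* m n) (0≤+ (m ℕ.* n))

_⊞_ : ∀ {i j} → i ≡ 0ℤ → j ≡ 0ℤ → i + j ≡ 0ℤ
_⊞_ = cong₂ _+_

_⊠_ : ∀ i {j} → j ≡ 0ℤ → i * j ≡ 0ℤ
i ⊠ j≡0 = trans (cong (i *_) j≡0) (ℤ.*-zeroʳ i)

i-j+j≡i : ∀ i j → i - j + j ≡ i
i-j+j≡i = solve-∀

zeroed : ∀ {i j} → i ≡ j → i - j ≡ 0ℤ
zeroed {i} refl = ℤ.+-inverseʳ i

by-combination : ∀ {i j k} → i ≡ 0ℤ → j - k ≡ i → j ≡ k
by-combination i≡0 j-k≡i = ℤ.i-j≡0⇒i≡j _ _ (trans j-k≡i i≡0)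

positive-zero : ∀ {i j} → i ≡ 0ℤ → 0ℤ ≤ j → i ≡ 1ℤ + j → ⊥
positive-zero i≡0 (+≤+ _) i≡1+j with trans (sym i≡0) i≡1+j
... | ()

-- In the following, τ = t + 1 and k = n + σ with σ = a + b + c; primed remainders are complementary:
-- τ + τ′ = s − 1, β + β′ = b − 1, α + α′ = c − 1.  L and K are the quotients of v by b and w by c; only
-- K ∈ {0, −1} and L ∈ {0, −1, −2} occur when −σ < n < 0.  The equations hv, hw and hd say s v = n − b t,
-- s w = n − c t and v − w = 2t.  An impossible pair is refuted by a linear combination of the equations
-- whose value is 1 plus a nonnegative expression.
module Window
  {s b τ τ′ β β′ α α′ k k′ k″ : ℤ}
  (0≤s-2 : 0ℤ ≤ s - + 2) (0≤b-3 : 0ℤ ≤ b - + 3) (0≤τ : 0ℤ ≤ τ) (0≤τ′ : 0ℤ ≤ τ′) (0≤β : 0ℤ ≤ β) (0≤β′ : 0ℤ ≤ β′)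
  (0≤α : 0ℤ ≤ α) (0≤α′ : 0ℤ ≤ α′) (0≤k′ : 0ℤ ≤ k′) (0≤k″ : 0ℤ ≤ k″)
  (hτ : τ + τ′ + 1ℤ ≡ s) (hβ : β + β′ + 1ℤ ≡ b) (hα : α + α′ + 1ℤ ≡ b + + 2 * s)
  (hk′ : k ≡ 1ℤ + k′) (hk″ : k + (1ℤ + k″) ≡ + 2 * b + + 3 * s)
  where

  private
    0≤s : 0ℤ ≤ s
    0≤s = subst (0ℤ ≤_) (i-j+j≡i s (+ 2)) (0≤s-2 ⊕ 0≤+ 2)

    0≤b : 0ℤ ≤ b
    0≤b = subst (0ℤ ≤_) (i-j+j≡i b (+ 3)) (0≤b-3 ⊕ 0≤+ 3)

    0≤c : 0ℤ ≤ b + + 2 * s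
    0≤c = 0≤b ⊕ 0≤+ 2 ⊗ 0≤s

  L≢1+ : ∀ l → 0ℤ ≤ l → s * (b * (1ℤ + l) + β) ≡ k - (+ 2 * b + + 3 * s) - b * (τ - 1ℤ) → ⊥
  L≢1+ l 0≤l hv = positive-zero (zeroed hv ⊞ zeroed hk″)
    (0≤b ⊗ 0≤s-2 ⊕ 0≤b ⊕ 0≤s ⊗ 0≤b ⊗ 0≤l ⊕ 0≤s ⊗ 0≤β ⊕ 0≤k″ ⊕ 0≤b ⊗ 0≤τ)
    (solve (s ∷ b ∷ l ∷ β ∷ τ ∷ k ∷ k″ ∷ []))

  L≢-[3+] : ∀ l → 0ℤ ≤ l → s * (b * - (+ 3 + l) + β) ≡ k - (+ 2 * b + + 3 * s) - b * (τ - 1ℤ) → ⊥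
  L≢-[3+] l 0≤l hv = positive-zero
    (- 1ℤ ⊠ zeroed hv ⊞ - 1ℤ ⊠ zeroed hk′ ⊞ b ⊠ zeroed hτ ⊞ s ⊠ zeroed hβ)
    (0≤k′ ⊕ 0≤s ⊗ (0≤+ 1 ⊕ 0≤b-3) ⊕ 0≤b ⊗ 0≤τ′ ⊕ 0≤s ⊗ 0≤b ⊗ 0≤l ⊕ 0≤s ⊗ 0≤β′)
    (solve (s ∷ b ∷ l ∷ β ∷ β′ ∷ τ ∷ τ′ ∷ k ∷ k′ ∷ []))

  K≢1+ : ∀ l → 0ℤ ≤ l → s * ((b + + 2 * s) * (1ℤ + l) + α) ≡ k - (+ 2 * b + + 3 * s) - (b + + 2 * s) * (τ - 1ℤ) → ⊥
  K≢1+ l 0≤l hw = positive-zero (zeroed hw ⊞ zeroed hk″)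
    (0≤c ⊗ 0≤s-2 ⊕ 0≤c ⊕ 0≤s ⊗ 0≤c ⊗ 0≤l ⊕ 0≤s ⊗ 0≤α ⊕ 0≤k″ ⊕ 0≤c ⊗ 0≤τ)
    (solve (s ∷ b ∷ l ∷ α ∷ τ ∷ k ∷ k″ ∷ []))

  K≢-[2+] : ∀ l → 0ℤ ≤ l → s * ((b + + 2 * s) * - (+ 2 + l) + α) ≡ k - (+ 2 * b + + 3 * s) - (b + + 2 * s) * (τ - 1ℤ) → ⊥
  K≢-[2+] l 0≤l hw = positive-zero
    (- 1ℤ ⊠ zeroed hw ⊞ - 1ℤ ⊠ zeroed hk′ ⊞ (b + + 2 * s) ⊠ zeroed hτ ⊞ s ⊠ zeroed hα)
    (0≤k′ ⊕ 0≤+ 2 ⊗ 0≤s ⊕ 0≤c ⊗ 0≤τ′ ⊕ 0≤s ⊗ 0≤c ⊗ 0≤l ⊕ 0≤s ⊗ 0≤α′)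
    (solve (s ∷ b ∷ l ∷ α ∷ α′ ∷ τ ∷ τ′ ∷ k ∷ k′ ∷ []))

  K≡0⇒L≢-2 : b * - + 2 + β ≡ (b + + 2 * s) * 0ℤ + α + + 2 * (τ - 1ℤ) → ⊥
  K≡0⇒L≢-2 hd = positive-zero (- 1ℤ ⊠ zeroed hd ⊞ zeroed hβ)
    (0≤α ⊕ 0≤+ 2 ⊗ 0≤τ ⊕ 0≤β′ ⊕ (0≤+ 1 ⊕ 0≤b-3))
    (solve (s ∷ b ∷ α ∷ β ∷ β′ ∷ τ ∷ []))

  K≡-1⇒L≢0 : s * (b * 0ℤ + β) ≡ k - (+ 2 * b + + 3 * s) - b * (τ - 1ℤ) → b * 0ℤ + β ≡ (b + + 2 * s) * - 1ℤ + α + + 2 * (τ - 1ℤ) → ⊥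
  K≡-1⇒L≢0 hv hd = positive-zero
    (+ 2 ⊠ zeroed hv ⊞ + 2 ⊠ zeroed hk″ ⊞ b ⊠ zeroed hd ⊞ b ⊠ zeroed hα)
    (0≤+ 2 ⊗ 0≤s ⊗ 0≤β ⊕ 0≤+ 2 ⊗ 0≤k″ ⊕ 0≤b ⊗ 0≤β ⊕ 0≤b ⊗ 0≤α′ ⊕ (0≤+ 1 ⊕ 0≤b))
    (solve (s ∷ b ∷ α ∷ α′ ∷ β ∷ τ ∷ k ∷ k″ ∷ []))

  K≡0⇒L≡-1 : b * - 1ℤ + β ≡ (b + + 2 * s) * 0ℤ + α + + 2 * (τ - 1ℤ) → β′ + α + (τ + τ) ≡ 1ℤ
  K≡0⇒L≡-1 hd = by-combination (- 1ℤ ⊠ zeroed hd ⊞ zeroed hβ)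
    (solve (s ∷ b ∷ α ∷ β ∷ β′ ∷ τ ∷ []))

  K≡-1⇒L≡-2 : b * - + 2 + β ≡ (b + + 2 * s) * - 1ℤ + α + + 2 * (τ - 1ℤ) → β′ + α ≡ + 3 + (τ′ + τ′)
  K≡-1⇒L≡-2 hd = by-combination (- 1ℤ ⊠ zeroed hd ⊞ zeroed hβ ⊞ - + 2 ⊠ zeroed hτ)
    (solve (s ∷ b ∷ α ∷ β ∷ β′ ∷ τ ∷ τ′ ∷ []))

  L≡-2⇒β′≢2+ : ∀ l → 0ℤ ≤ l → β′ ≡ + 2 + l → s * (b * - + 2 + β) ≡ k - (+ 2 * b + + 3 * s) - b * (τ - 1ℤ) → ⊥
  L≡-2⇒β′≢2+ l 0≤l hβ′ hv = positive-zero
    (- 1ℤ ⊠ zeroed hv ⊞ - 1ℤ ⊠ zeroed hk′ ⊞ b ⊠ zeroed hτ ⊞ s ⊠ zeroed hβ ⊞ - s ⊠ zeroed hβ′)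
    (0≤k′ ⊕ 0≤b ⊗ 0≤τ′ ⊕ 0≤s ⊗ 0≤l)
    (solve (s ∷ b ∷ l ∷ β ∷ β′ ∷ τ ∷ τ′ ∷ k ∷ k′ ∷ []))

  K≡L≡-1 : b * - 1ℤ + β ≡ (b + + 2 * s) * - 1ℤ + α + + 2 * (τ - 1ℤ) → α′ + + 2 ≡ β′ + (τ + τ)
  K≡L≡-1 hd = by-combination (zeroed hd ⊞ zeroed hα ⊞ - 1ℤ ⊠ zeroed hβ)
    (solve (s ∷ b ∷ α ∷ α′ ∷ β ∷ β′ ∷ τ ∷ []))

  K≡0⇒τ≢1+ : ∀ l → 0ℤ ≤ l → τ ≡ 1ℤ + l → s * ((b + + 2 * s) * 0ℤ + α) ≡ k - (+ 2 * b + + 3 * s) - (b + + 2 * s) * (τ - 1ℤ) → ⊥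
  K≡0⇒τ≢1+ l 0≤l hτ₁ hw = positive-zero (zeroed hw ⊞ zeroed hk″ ⊞ - (b + + 2 * s) ⊠ zeroed hτ₁)
    (0≤s ⊗ 0≤α ⊕ 0≤k″ ⊕ 0≤c ⊗ 0≤l)
    (solve (s ∷ b ∷ l ∷ α ∷ τ ∷ k ∷ k″ ∷ []))

  K≡L≡0 : b * 0ℤ + β ≡ (b + + 2 * s) * 0ℤ + α + + 2 * (τ - 1ℤ) → β + + 2 ≡ α + (τ + τ)
  K≡L≡0 hd = by-combination (zeroed hd)
    (solve (s ∷ b ∷ α ∷ β ∷ τ ∷ []))

sgn : ℕ → ℤ
sgn zero    = 1ℤ
sgn (suc n) = - sgn n

sgn-+ : ∀ i j → sgn (i ℕ.+ j) ≡ sgn i * sgn j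
sgn-+ zero    j = sym (ℤ.*-identityˡ _)
sgn-+ (suc i) j = trans (cong -_ (sgn-+ i j)) (ℤ.neg-distribˡ-* (sgn i) (sgn j))

sgn²≡1 : ∀ i → sgn i * sgn i ≡ 1ℤ
sgn²≡1 zero    = refl
sgn²≡1 (suc i) = trans (neg² (sgn i)) (sgn²≡1 i)
  where
  neg² : ∀ z → - z * - z ≡ z * z
  neg² = solve-∀

sgn-+-even : ∀ i n → sgn (i ℕ.+ (n ℕ.+ n)) ≡ sgn i
sgn-+-even i n = begin
  sgn (i ℕ.+ (n ℕ.+ n))      ≡⟨ sgn-+ i (n ℕ.+ n) ⟩
  sgn i * sgn (n ℕ.+ n)      ≡⟨ cong (sgn i *_) (trans (sgn-+ n n) (sgn²≡1 n)) ⟩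
  sgn i * 1ℤ                 ≡⟨ ℤ.*-identityʳ _ ⟩
  sgn i                      ∎
  where open ≡-Reasoning

sgn-same : ∀ i j p q → i ℕ.+ (p ℕ.+ p) ≡ j ℕ.+ (q ℕ.+ q) → sgn i ≡ sgn j
sgn-same i j p q eq = trans (sym (sgn-+-even i p)) (trans (cong sgn eq) (sgn-+-even j q))

sgn-sum-even : ∀ i j n → i ℕ.+ j ≡ n ℕ.+ n → sgn i ≡ sgn j
sgn-sum-even i j n eq = sgn-same i j j n (trans (arith i j) (trans (cong (ℕ._+ j) eq) (ℕ.+-comm (n ℕ.+ n) j)))
  where
  arith : ∀ i j → i ℕ.+ (j ℕ.+ j) ≡ i ℕ.+ j ℕ.+ j
  arith = ℕ-Solver.solve-∀

sgn-sum-odd : ∀ i j n → i ℕ.+ j ≡ suc (n ℕ.+ n) → sgn j ≡ - sgn i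
sgn-sum-odd i j n eq =
  trans (sym (ℤ.neg-involutive (sgn j))) (cong -_ (sym (sgn-sum-even i (suc j) (suc n) (trans (ℕ.+-suc i j) (trans (cong suc eq) (cong suc (sym (ℕ.+-suc n n))))))))

sgn≤1 : ∀ i → sgn i ≤ 1ℤ
-1≤sgn : ∀ i → -1ℤ ≤ sgn i
sgn≤1 zero    = +≤+ (ℕ.s≤s ℕ.z≤n)
sgn≤1 (suc i) = ℤ.neg-mono-≤ (-1≤sgn i)
-1≤sgn zero    = -≤+
-1≤sgn (suc i) = ℤ.neg-mono-≤ (sgn≤1 i)

-- 8Δ₁ p(n) at k = n + 2b + 3s and τ = t + 1, with e = (−1)^β and e′ = (−1)^α.
formula : (s b k τ β α e e′ : ℤ) → ℤ
formula s b k τ β α e e′ = let c = b + + 2 * s in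
  + 4 * k * (k - (+ 2 * b + + 3 * s)) + + 8 * (s * b * c) + + 4 * b * c * (τ - 1ℤ) * (s - 1ℤ - τ)
  + + 2 * s * c * β * (b - 1ℤ - β - + 2) - + 2 * s * b * α * (c - 1ℤ - α + + 2) + s * b * c * (e - e′)

-- 8 times the double sum for p(n), with K = ⌊w/c⌋ and L = ⌊v/b⌋, continued to negative K and L.
count : (s b u τ K L e e′ : ℤ) → ℤ
count s b u τ K L e e′ =
  + 8 * (K + 1ℤ) * τ + + 4 * s * K * (K + 1ℤ) + (L - K) * (+ 4 * (u + τ - 1ℤ) + + 6)
  - + 2 * b * (L * (L + 1ℤ) - K * (K + 1ℤ)) + (e - e′)

formula≡count : ∀ s b u τ K L e e′ → let c = b + + 2 * s in
  formula s b ((b + s) * (τ + 1ℤ) + s * (u + 1ℤ)) τ (u + τ - 1ℤ - b * L) (u - τ + 1ℤ - c * K) e e′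
    ≡ s * b * c * count s b u τ K L e e′
formula≡count = expand
  where
  expand : ∀ s b u τ K L e e′ →
    let c = b + + 2 * s ; k = (b + s) * (τ + 1ℤ) + s * (u + 1ℤ)
        β = u + τ - 1ℤ - b * L ; α = u - τ + 1ℤ - c * K in
    + 4 * k * (k - (+ 2 * b + + 3 * s)) + + 8 * (s * b * c) + + 4 * b * c * (τ - 1ℤ) * (s - 1ℤ - τ)
    + + 2 * s * c * β * (b - 1ℤ - β - + 2) - + 2 * s * b * α * (c - 1ℤ - α + + 2) + s * b * c * (e - e′)
    ≡ s * b * c * (+ 8 * (K + 1ℤ) * τ + + 4 * s * K * (K + 1ℤ) + (L - K) * (+ 4 * (u + τ - 1ℤ) + + 6)
      - + 2 * b * (L * (L + 1ℤ) - K * (K + 1ℤ)) + (e - e′))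
  expand = solve-∀

module _
  {s b : ℤ} (0≤s-2 : 0ℤ ≤ s - + 2) (0≤b-3 : 0ℤ ≤ b - + 3)
  (τ τ′ β β′ α α′ k′ k″ : ℕ) {k : ℤ}
  (hτ : + τ + + τ′ + 1ℤ ≡ s) (hβ : + β + + β′ + 1ℤ ≡ b) (hα : + α + + α′ + 1ℤ ≡ b + + 2 * s)
  (hk′ : k ≡ 1ℤ + + k′) (hk″ : k + (1ℤ + + k″) ≡ + 2 * b + + 3 * s)
  (sgnβ : sgn β ≡ sgn β′) (sgnα : sgn α ≡ sgn α′)
  where

  private
    c σ : ℤ
    c = b + + 2 * s
    σ = + 2 * b + + 3 * s

  open Window 0≤s-2 0≤b-3 (0≤+ τ) (0≤+ τ′) (0≤+ β) (0≤+ β′) (0≤+ α) (0≤+ α′) (0≤+ k′) (0≤+ k″)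
    hτ hβ hα hk′ hk″

  small : ∀ {β′} {e′} → (∀ l → β′ ≡ 2 ℕ.+ l → ⊥) → e′ ≡ - sgn β′ → + 4 * + β′ - + 2 + (sgn β′ - e′) ≡ 0ℤ
  small {0}           _   refl = refl
  small {1}           _   refl = refl
  small {suc (suc l)} big _    = ⊥-elim (big l refl)

  count≡0 : ∀ u K L → u + + τ - 1ℤ ≡ b * L + + β →
    s * (b * L + + β) ≡ k - σ - b * (+ τ - 1ℤ) →
    s * (c * K + + α) ≡ k - σ - c * (+ τ - 1ℤ) →
    b * L + + β ≡ c * K + + α + + 2 * (+ τ - 1ℤ) →
    count s b u (+ τ) K L (sgn β) (sgn α) ≡ 0ℤ
  count≡0 u +[1+ l ] L hL hv hw hd = ⊥-elim (K≢1+ (+ l) (0≤+ l) hw)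
  count≡0 u -[1+ suc l ] L hL hv hw hd = ⊥-elim (K≢-[2+] (+ l) (0≤+ l) hw)
  count≡0 u (+ 0) +[1+ l ] hL hv hw hd = ⊥-elim (L≢1+ (+ l) (0≤+ l) hv)
  count≡0 u -[1+ 0 ] +[1+ l ] hL hv hw hd = ⊥-elim (L≢1+ (+ l) (0≤+ l) hv)
  count≡0 u (+ 0) -[1+ suc (suc l) ] hL hv hw hd = ⊥-elim (L≢-[3+] (+ l) (0≤+ l) hv)
  count≡0 u -[1+ 0 ] -[1+ suc (suc l) ] hL hv hw hd = ⊥-elim (L≢-[3+] (+ l) (0≤+ l) hv)
  count≡0 u (+ 0) -[1+ 1 ] hL hv hw hd = ⊥-elim (K≡0⇒L≢-2 hd)
  count≡0 u -[1+ 0 ] (+ 0) hL hv hw hd = ⊥-elim (K≡-1⇒L≢0 hv hd)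
  count≡0 u (+ 0) (+ 0) hL hv hw hd = zero-zero τ refl
    where
    at : ∀ s b u e → + 8 * (0ℤ + 1ℤ) * 0ℤ + + 4 * s * 0ℤ * (0ℤ + 1ℤ) + (0ℤ - 0ℤ) * (+ 4 * (u + 0ℤ - 1ℤ) + + 6)
      - + 2 * b * (0ℤ * (0ℤ + 1ℤ) - 0ℤ * (0ℤ + 1ℤ)) + (e - e) ≡ 0ℤ
    at = solve-∀

    zero-zero : ∀ t → t ≡ τ → count s b u (+ t) 0ℤ 0ℤ (sgn β) (sgn α) ≡ 0ℤ
    zero-zero (suc t) eq = ⊥-elim (K≡0⇒τ≢1+ (+ t) (0≤+ t) (cong +_ (sym eq)) hw)
    zero-zero zero    _  =
      trans (cong (λ e → count s b u 0ℤ 0ℤ 0ℤ e (sgn α)) (sgn-same β α 1 τ (ℤ.+-injective (K≡L≡0 hd))))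
            (at s b u (sgn α))
  count≡0 u (+ 0) -[1+ 0 ] hL hv hw hd = trans
    (cong (λ e → count s b u (+ τ) 0ℤ -1ℤ e (sgn α)) sgnβ)
    (trans (by-combination (- + 4 ⊠ zeroed hL ⊞ - + 4 ⊠ zeroed hβ ⊞ + 8 ⊠ zeroed (cong +_ (τ≡0 τ (β′ ℕ.+ α) hsum))) (at s b u (+ τ) (+ β) (+ β′) (sgn β′) (sgn α)))
           (small big (sgn-sum-odd β′ α 0 (sum≡1 τ (β′ ℕ.+ α) hsum))))
    where
    hsum : β′ ℕ.+ α ℕ.+ (τ ℕ.+ τ) ≡ 1
    hsum = ℤ.+-injective (K≡0⇒L≡-1 hd)

    τ≡0 : ∀ t j → j ℕ.+ (t ℕ.+ t) ≡ 1 → t ≡ 0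
    τ≡0 zero    _       _  = refl
    τ≡0 (suc t) zero    eq with trans (sym (ℕ.+-suc t t)) (ℕ.suc-injective eq)
    ... | ()
    τ≡0 (suc t) (suc j) eq with trans (sym (ℕ.+-suc j _)) (ℕ.suc-injective eq)
    ... | ()

    sum≡1 : ∀ t j → j ℕ.+ (t ℕ.+ t) ≡ 1 → j ≡ 1
    sum≡1 t j eq with refl ← τ≡0 t j eq = trans (sym (ℕ.+-identityʳ j)) eq

    big : ∀ l → β′ ≡ 2 ℕ.+ l → ⊥
    big l refl with sum≡1 τ (suc (suc (l ℕ.+ α))) hsum
    ... | ()

    at : ∀ s b u τ β β′ e e′ →
      + 8 * (0ℤ + 1ℤ) * τ + + 4 * s * 0ℤ * (0ℤ + 1ℤ) + (- 1ℤ - 0ℤ) * (+ 4 * (u + τ - 1ℤ) + + 6)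
        - + 2 * b * (- 1ℤ * (- 1ℤ + 1ℤ) - 0ℤ * (0ℤ + 1ℤ)) + (e - e′)
        - (+ 4 * β′ - + 2 + (e - e′))
      ≡ - + 4 * (u + τ - 1ℤ - (b * - 1ℤ + β)) + - + 4 * (β + β′ + 1ℤ - b) + + 8 * (τ - 0ℤ)
    at = solve-∀
  count≡0 u -[1+ 0 ] -[1+ 1 ] hL hv hw hd = trans
    (cong (λ e → count s b u (+ τ) -1ℤ -[1+ 1 ] e (sgn α)) sgnβ)
    (trans (by-combination (- + 4 ⊠ zeroed hL ⊞ - + 4 ⊠ zeroed hβ) (at s b u (+ τ) (+ β) (+ β′) (sgn β′) (sgn α)))
           (small (λ l β′≡2+l → L≡-2⇒β′≢2+ (+ l) (0≤+ l) (cong +_ β′≡2+l) hv)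
                  (sgn-sum-odd β′ α (suc τ′) (trans (ℤ.+-injective (K≡-1⇒L≡-2 hd)) (cong (λ z → suc (suc z)) (sym (ℕ.+-suc τ′ τ′)))))))
    where
    at : ∀ s b u τ β β′ e e′ →
      + 8 * (- 1ℤ + 1ℤ) * τ + + 4 * s * - 1ℤ * (- 1ℤ + 1ℤ) + (- + 2 - - 1ℤ) * (+ 4 * (u + τ - 1ℤ) + + 6)
        - + 2 * b * (- + 2 * (- + 2 + 1ℤ) - - 1ℤ * (- 1ℤ + 1ℤ)) + (e - e′)
        - (+ 4 * β′ - + 2 + (e - e′))
      ≡ - + 4 * (u + τ - 1ℤ - (b * - + 2 + β)) + - + 4 * (β + β′ + 1ℤ - b)
    at = solve-∀
  count≡0 u -[1+ 0 ] -[1+ 0 ] hL hv hw hd = trans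
    (cong₂ (count s b u (+ τ) -1ℤ -1ℤ) (trans sgnβ (sym (sgn-same α′ β′ 1 τ (ℤ.+-injective (K≡L≡-1 hd))))) sgnα)
    (at s b u (+ τ) (sgn α′))
    where
    at : ∀ s b u τ e →
      + 8 * (- 1ℤ + 1ℤ) * τ + + 4 * s * - 1ℤ * (- 1ℤ + 1ℤ) + (- 1ℤ - - 1ℤ) * (+ 4 * (u + τ - 1ℤ) + + 6)
        - + 2 * b * (- 1ℤ * (- 1ℤ + 1ℤ) - - 1ℤ * (- 1ℤ + 1ℤ)) + (e - e)
      ≡ 0ℤ
    at = solve-∀

  formula≡0 : ∀ u K L → k ≡ (b + s) * (+ τ + 1ℤ) + s * (u + 1ℤ) →
    u + + τ - 1ℤ ≡ b * L + + β → u - + τ + 1ℤ ≡ c * K + + α →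
    formula s b k (+ τ) (+ β) (+ α) (sgn β) (sgn α) ≡ 0ℤ
  formula≡0 u K L hk hL hK = begin
    formula s b k (+ τ) (+ β) (+ α) (sgn β) (sgn α)
      ≡⟨ cong (λ z → formula s b z (+ τ) (+ β) (+ α) (sgn β) (sgn α)) hk ⟩
    formula s b ((b + s) * (+ τ + 1ℤ) + s * (u + 1ℤ)) (+ τ) (+ β) (+ α) (sgn β) (sgn α)
      ≡⟨ cong₂ (λ y z → formula s b ((b + s) * (+ τ + 1ℤ) + s * (u + 1ℤ)) (+ τ) y z (sgn β) (sgn α))
               (solve-for-remainder hL) (solve-for-remainder hK) ⟩
    formula s b ((b + s) * (+ τ + 1ℤ) + s * (u + 1ℤ)) (+ τ) (u + + τ - 1ℤ - b * L) (u - + τ + 1ℤ - c * K) (sgn β) (sgn α)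
      ≡⟨ formula≡count s b u (+ τ) K L (sgn β) (sgn α) ⟩
    s * b * c * count s b u (+ τ) K L (sgn β) (sgn α)
      ≡⟨ (s * b * c) ⊠ count≡0 u K L hL
           (by-combination (- s ⊠ zeroed hL ⊞ -1ℤ ⊠ zeroed hk) (v-eq s b u k (+ τ) (b * L + + β)))
           (by-combination (- s ⊠ zeroed hK ⊞ -1ℤ ⊠ zeroed hk) (w-eq s b u k (+ τ) (c * K + + α)))
           (by-combination (-1ℤ ⊠ zeroed hL ⊞ zeroed hK) (v-w-eq u (+ τ) (b * L + + β) (c * K + + α))) ⟩
    0ℤ ∎
    where
    open ≡-Reasoning

    solve-for-remainder : ∀ {v w r} → v ≡ w + r → r ≡ v - w
    solve-for-remainder {w = w} {r} refl = cancel w r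
      where
      cancel : ∀ w r → r ≡ w + r - w
      cancel = solve-∀

    v-eq : ∀ s b u k τ v →
      s * v - (k - (+ 2 * b + + 3 * s) - b * (τ - 1ℤ))
      ≡ - s * (u + τ - 1ℤ - v) + - 1ℤ * (k - ((b + s) * (τ + 1ℤ) + s * (u + 1ℤ)))
    v-eq = solve-∀

    w-eq : ∀ s b u k τ w →
      s * w - (k - (+ 2 * b + + 3 * s) - (b + + 2 * s) * (τ - 1ℤ))
      ≡ - s * (u - τ + 1ℤ - w) + - 1ℤ * (k - ((b + s) * (τ + 1ℤ) + s * (u + 1ℤ)))
    w-eq = solve-∀

    v-w-eq : ∀ u τ v w → v - (w + + 2 * (τ - 1ℤ)) ≡ - 1ℤ * (u + τ - 1ℤ - v) + (u - τ + 1ℤ - w)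
    v-w-eq = solve-∀

-- Bounds for the formula

num₂ : (r s n : ℤ) → ℤ
num₂ r s n = n ^ 2 + + 2 * n * r + n * s + + 2 * r + s - 1ℤ

numᵘ : (r s : ℤ) → ℤ
numᵘ r s = r ^ 3 * (+ 2 * s ^ 2 - s) + r ^ 2 * (+ 2 * s - + 2 * s ^ 3)
  + r * (- (+ 2 * s ^ 4) + s ^ 3 - + 2 * s - 1ℤ) + + 2 * s ^ 5 - + 2 * s ^ 3 + + 2 * s ^ 2 - s + 1ℤ

numᵈ : (r s : ℤ) → ℤ
numᵈ r s = r ^ 3 * (- (+ 2 * s ^ 2) - s) + + 2 * r ^ 2 * s ^ 3
  + r * (+ 2 * s ^ 4 + s ^ 3 + + 2 * s - 1ℤ) - + 2 * s ^ 5 - + 2 * s ^ 2 - s + 1ℤ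

Bounds : (r s n d y : ℤ) → Set
Bounds r s n d y = num₂ r s n + numᵈ r s ≤ y * d × y * d ≤ num₂ r s n + numᵘ r s

module _ {t t′ : ℤ} (0≤t : 0ℤ ≤ t) (0≤t′ : 0ℤ ≤ t′) where

  square-bound : ∀ {m} → t + t′ + 1ℤ ≡ m → 0ℤ ≤ (m - 1ℤ) * (m - 1ℤ) - (t - 1ℤ) * (m - 1ℤ - t)
  square-bound refl = subst (0ℤ ≤_) (expand t t′) (0≤t ⊗ 0≤t ⊕ 0≤t ⊗ 0≤t′ ⊕ 0≤t′ ⊗ 0≤t′ ⊕ 0≤t′)
    where
    expand : ∀ t t′ → let m = t + t′ + 1ℤ in
      t * t + t * t′ + t′ * t′ + t′ ≡ (m - 1ℤ) * (m - 1ℤ) - (t - 1ℤ) * (m - 1ℤ - t)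
    expand = solve-∀

  square-bound′ : ∀ {m} → t + t′ + 1ℤ ≡ m → 0ℤ ≤ (m - 1ℤ) * (m - 1ℤ) - t * (m - 1ℤ - t - + 2)
  square-bound′ refl = subst (0ℤ ≤_) (expand t t′) (0≤t ⊗ 0≤t ⊕ 0≤t ⊗ 0≤t′ ⊕ 0≤t′ ⊗ 0≤t′ ⊕ 0≤+ 2 ⊗ 0≤t)
    where
    expand : ∀ t t′ → let m = t + t′ + 1ℤ in
      t * t + t * t′ + t′ * t′ + + 2 * t ≡ (m - 1ℤ) * (m - 1ℤ) - t * (m - 1ℤ - t - + 2)
    expand = solve-∀

  product-bound : ∀ {m} → t + t′ + 1ℤ ≡ m → 0ℤ ≤ t * (m - 1ℤ - t + + 2)
  product-bound refl = subst (0ℤ ≤_) (expand t t′) (0≤t ⊗ (0≤t′ ⊕ 0≤+ 2))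
    where
    expand : ∀ t t′ → let m = t + t′ + 1ℤ in t * (t′ + + 2) ≡ t * (m - 1ℤ - t + + 2)
    expand = solve-∀

  linear-bound : ∀ {m} → t + t′ + 1ℤ ≡ m → 0ℤ ≤ (t - 1ℤ) * (m - 1ℤ - t) + (m - 1ℤ)
  linear-bound refl = subst (0ℤ ≤_) (expand t t′) (0≤t ⊗ 0≤t′ ⊕ 0≤t)
    where
    expand : ∀ t t′ → let m = t + t′ + 1ℤ in t * t′ + t ≡ (t - 1ℤ) * (m - 1ℤ - t) + (m - 1ℤ)
    expand = solve-∀

  linear-bound′ : ∀ {m} → t + t′ + 1ℤ ≡ m → 0ℤ ≤ t * (m - 1ℤ - t - + 2) + + 2 * (m - 1ℤ)
  linear-bound′ refl = subst (0ℤ ≤_) (expand t t′) (0≤t ⊗ 0≤t′ ⊕ 0≤+ 2 ⊗ 0≤t′)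
    where
    expand : ∀ t t′ → let m = t + t′ + 1ℤ in t * t′ + + 2 * t′ ≡ t * (m - 1ℤ - t - + 2) + + 2 * (m - 1ℤ)
    expand = solve-∀

  product-square-bound : ∀ {m} → t + t′ + 1ℤ ≡ m →
    0ℤ ≤ (m - 1ℤ) * (m - 1ℤ) + + 2 * (m - 1ℤ) - t * (m - 1ℤ - t + + 2)
  product-square-bound refl =
    subst (0ℤ ≤_) (expand t t′) (0≤t ⊗ 0≤t ⊕ 0≤t ⊗ 0≤t′ ⊕ 0≤t′ ⊗ 0≤t′ ⊕ 0≤+ 2 ⊗ 0≤t′)
    where
    expand : ∀ t t′ → let m = t + t′ + 1ℤ in
      t * t + t * t′ + t′ * t′ + + 2 * t′ ≡ (m - 1ℤ) * (m - 1ℤ) + + 2 * (m - 1ℤ) - t * (m - 1ℤ - t + + 2)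
    expand = solve-∀

upper-margin : (s b : ℤ) → ℤ
upper-margin s b = let c = b + + 2 * s in
  + 4 * (+ 2 * (b + s) + s - 1ℤ + numᵘ (b + s) s) - (+ 10 * (s * b * c) + + 4 * b * c * ((s - 1ℤ) * (s - 1ℤ)) + + 2 * s * c * ((b - 1ℤ) * (b - 1ℤ)))

lower-margin : (s b : ℤ) → ℤ
lower-margin s b = let c = b + + 2 * s in
  + 6 * (s * b * c) - + 4 * b * c * (s - 1ℤ) - + 4 * s * c * (b - 1ℤ) - + 2 * s * b * ((c - 1ℤ) * (c - 1ℤ) + + 2 * (c - 1ℤ))
  - + 4 * (+ 2 * (b + s) + s - 1ℤ + numᵈ (b + s) s)

-- Both margins have nonnegative coefficients as polynomials in y = s − 2 and x = b − s − 1.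
0≤upper-margin : ∀ {x y} → 0ℤ ≤ x → 0ℤ ≤ y → 0ℤ ≤ upper-margin (+ 2 + y) (+ 3 + y + x)
0≤upper-margin {x} {y} 0≤x 0≤y = subst (0ℤ ≤_) (expand x y)
  ((0≤+ 868 ⊕ (0≤+ 2242 ⊕ (0≤+ 2216 ⊕ (0≤+ 1068 ⊕ (0≤+ 254 ⊕ (0≤+ 24) ⊗ 0≤y) ⊗ 0≤y) ⊗ 0≤y) ⊗ 0≤y) ⊗ 0≤y) ⊕ ((0≤+ 844 ⊕ (0≤+ 1792 ⊕ (0≤+ 1368 ⊕ (0≤+ 454 ⊕ (0≤+ 56) ⊗ 0≤y) ⊗ 0≤y) ⊗ 0≤y) ⊗ 0≤y) ⊕ ((0≤+ 244 ⊕ (0≤+ 416 ⊕ (0≤+ 226 ⊕ (0≤+ 40) ⊗ 0≤y) ⊗ 0≤y) ⊗ 0≤y) ⊕ (0≤+ 20 ⊕ (0≤+ 26 ⊕ (0≤+ 8) ⊗ 0≤y) ⊗ 0≤y) ⊗ 0≤x) ⊗ 0≤x) ⊗ 0≤x)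
  where
  expand : ∀ x y →
    let s = + 2 + y ; b = + 3 + y + x ; c = b + + 2 * s ; r = b + s in
    (+ 868 + (+ 2242 + (+ 2216 + (+ 1068 + (+ 254 + (+ 24) * y) * y) * y) * y) * y) + ((+ 844 + (+ 1792 + (+ 1368 + (+ 454 + (+ 56) * y) * y) * y) * y) + ((+ 244 + (+ 416 + (+ 226 + (+ 40) * y) * y) * y) + (+ 20 + (+ 26 + (+ 8) * y) * y) * x) * x) * x
    ≡ + 4 * (+ 2 * r + s - 1ℤ + ((r * (r * (r * 1ℤ))) * (+ 2 * (s * (s * 1ℤ)) - s) + (r * (r * 1ℤ)) * (+ 2 * s - + 2 * (s * (s * (s * 1ℤ))))
      + r * (- (+ 2 * (s * (s * (s * (s * 1ℤ))))) + (s * (s * (s * 1ℤ))) - + 2 * s - 1ℤ)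
      + + 2 * (s * (s * (s * (s * (s * 1ℤ))))) - + 2 * (s * (s * (s * 1ℤ))) + + 2 * (s * (s * 1ℤ)) - s + 1ℤ))
      - (+ 10 * (s * b * c) + + 4 * b * c * ((s - 1ℤ) * (s - 1ℤ)) + + 2 * s * c * ((b - 1ℤ) * (b - 1ℤ)))
  expand = solve-∀

0≤lower-margin : ∀ {x y} → 0ℤ ≤ x → 0ℤ ≤ y → 0ℤ ≤ lower-margin (+ 2 + y) (+ 3 + y + x)
0≤lower-margin {x} {y} 0≤x 0≤y = subst (0ℤ ≤_) (expand x y)
  ((0≤+ 2268 ⊕ (0≤+ 4598 ⊕ (0≤+ 3724 ⊕ (0≤+ 1504 ⊕ (0≤+ 302 ⊕ (0≤+ 24) ⊗ 0≤y) ⊗ 0≤y) ⊗ 0≤y) ⊗ 0≤y) ⊗ 0≤y) ⊕ ((0≤+ 1828 ⊕ (0≤+ 3080 ⊕ (0≤+ 1944 ⊕ (0≤+ 542 ⊕ (0≤+ 56) ⊗ 0≤y) ⊗ 0≤y) ⊗ 0≤y) ⊗ 0≤y) ⊕ ((0≤+ 468 ⊕ (0≤+ 620 ⊕ (0≤+ 274 ⊕ (0≤+ 40) ⊗ 0≤y) ⊗ 0≤y) ⊗ 0≤y) ⊕ (0≤+ 36 ⊕ (0≤+ 34 ⊕ (0≤+ 8) ⊗ 0≤y) ⊗ 0≤y) ⊗ 0≤x) ⊗ 0≤x) ⊗ 0≤x)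
  where
  expand : ∀ x y →
    let s = + 2 + y ; b = + 3 + y + x ; c = b + + 2 * s ; r = b + s in
    (+ 2268 + (+ 4598 + (+ 3724 + (+ 1504 + (+ 302 + (+ 24) * y) * y) * y) * y) * y) + ((+ 1828 + (+ 3080 + (+ 1944 + (+ 542 + (+ 56) * y) * y) * y) * y) + ((+ 468 + (+ 620 + (+ 274 + (+ 40) * y) * y) * y) + (+ 36 + (+ 34 + (+ 8) * y) * y) * x) * x) * x
    ≡ + 6 * (s * b * c) - + 4 * b * c * (s - 1ℤ) - + 4 * s * c * (b - 1ℤ) - + 2 * s * b * ((c - 1ℤ) * (c - 1ℤ) + + 2 * (c - 1ℤ))
      - + 4 * (+ 2 * r + s - 1ℤ + ((r * (r * (r * 1ℤ))) * (- (+ 2 * (s * (s * 1ℤ))) - s) + + 2 * (r * (r * 1ℤ)) * (s * (s * (s * 1ℤ)))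
      + r * (+ 2 * (s * (s * (s * (s * 1ℤ)))) + (s * (s * (s * 1ℤ))) + + 2 * s - 1ℤ)
      - + 2 * (s * (s * (s * (s * (s * 1ℤ))))) - + 2 * (s * (s * 1ℤ)) - s + 1ℤ))
  expand = solve-∀

module _
  {x y s b} (0≤x : 0ℤ ≤ x) (0≤y : 0ℤ ≤ y) (s≡ : s ≡ + 2 + y) (b≡ : b ≡ + 3 + y + x)
  {τ τ′ β β′ α α′ e e′ : ℤ}
  (0≤τ : 0ℤ ≤ τ) (0≤τ′ : 0ℤ ≤ τ′) (0≤β : 0ℤ ≤ β) (0≤β′ : 0ℤ ≤ β′) (0≤α : 0ℤ ≤ α) (0≤α′ : 0ℤ ≤ α′)
  (hτ : τ + τ′ + 1ℤ ≡ s) (hβ : β + β′ + 1ℤ ≡ b) (hα : α + α′ + 1ℤ ≡ b + + 2 * s)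
  (e≤1 : e ≤ 1ℤ) (-1≤e : -1ℤ ≤ e) (e′≤1 : e′ ≤ 1ℤ) (-1≤e′ : -1ℤ ≤ e′) (n : ℤ)
  where

  private
    c σ : ℤ
    c = b + + 2 * s
    σ = + 2 * b + + 3 * s

    0≤s : 0ℤ ≤ s
    0≤s = subst (0ℤ ≤_) (sym s≡) (0≤+ 2 ⊕ 0≤y)

    0≤b : 0ℤ ≤ b
    0≤b = subst (0ℤ ≤_) (sym b≡) (0≤+ 3 ⊕ 0≤y ⊕ 0≤x)

    0≤c : 0ℤ ≤ c
    0≤c = 0≤b ⊕ 0≤+ 2 ⊗ 0≤s

    0≤1-e : 0ℤ ≤ 1ℤ - e
    0≤1-e = ℤ.i≤j⇒0≤j-i e≤1

    0≤e+1 : 0ℤ ≤ e - -1ℤ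
    0≤e+1 = ℤ.i≤j⇒0≤j-i -1≤e

    0≤1-e′ : 0ℤ ≤ 1ℤ - e′
    0≤1-e′ = ℤ.i≤j⇒0≤j-i e′≤1

    0≤e′+1 : 0ℤ ≤ e′ - -1ℤ
    0≤e′+1 = ℤ.i≤j⇒0≤j-i -1≤e′

  formula≤ : formula s b (n + σ) τ β α e e′ ≤ + 4 * (num₂ (b + s) s n + numᵘ (b + s) s)
  formula≤ = ℤ.0≤i-j⇒j≤i (subst (0ℤ ≤_) (sym (split s b n τ β α e e′))
    (subst₂ (λ s b → 0ℤ ≤ upper-margin s b) (sym s≡) (sym b≡) (0≤upper-margin 0≤x 0≤y)
      ⊕ 0≤+ 4 ⊗ 0≤b ⊗ 0≤c ⊗ square-bound 0≤τ 0≤τ′ hτ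
      ⊕ 0≤+ 2 ⊗ 0≤s ⊗ 0≤c ⊗ square-bound′ 0≤β 0≤β′ hβ
      ⊕ 0≤+ 2 ⊗ 0≤s ⊗ 0≤b ⊗ product-bound 0≤α 0≤α′ hα
      ⊕ 0≤s ⊗ 0≤b ⊗ 0≤c ⊗ (0≤1-e ⊕ 0≤e′+1)))
    where
    split : ∀ s b n τ β α e e′ →
      let c = b + + 2 * s ; r = b + s ; k = n + (+ 2 * b + + 3 * s) in
      + 4 * ((n * (n * 1ℤ)) + + 2 * n * r + n * s + + 2 * r + s - 1ℤ
      + ((r * (r * (r * 1ℤ))) * (+ 2 * (s * (s * 1ℤ)) - s) + (r * (r * 1ℤ)) * (+ 2 * s - + 2 * (s * (s * (s * 1ℤ))))
      + r * (- (+ 2 * (s * (s * (s * (s * 1ℤ))))) + (s * (s * (s * 1ℤ))) - + 2 * s - 1ℤ)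
      + + 2 * (s * (s * (s * (s * (s * 1ℤ))))) - + 2 * (s * (s * (s * 1ℤ))) + + 2 * (s * (s * 1ℤ)) - s + 1ℤ))
      - (+ 4 * k * (k - (+ 2 * b + + 3 * s)) + + 8 * (s * b * c) + + 4 * b * c * (τ - 1ℤ) * (s - 1ℤ - τ)
      + + 2 * s * c * β * (b - 1ℤ - β - + 2) - + 2 * s * b * α * (c - 1ℤ - α + + 2) + s * b * c * (e - e′))
      ≡ + 4 * (+ 2 * r + s - 1ℤ + ((r * (r * (r * 1ℤ))) * (+ 2 * (s * (s * 1ℤ)) - s) + (r * (r * 1ℤ)) * (+ 2 * s - + 2 * (s * (s * (s * 1ℤ))))
      + r * (- (+ 2 * (s * (s * (s * (s * 1ℤ))))) + (s * (s * (s * 1ℤ))) - + 2 * s - 1ℤ)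
      + + 2 * (s * (s * (s * (s * (s * 1ℤ))))) - + 2 * (s * (s * (s * 1ℤ))) + + 2 * (s * (s * 1ℤ)) - s + 1ℤ))
      - (+ 10 * (s * b * c) + + 4 * b * c * ((s - 1ℤ) * (s - 1ℤ)) + + 2 * s * c * ((b - 1ℤ) * (b - 1ℤ)))
      + + 4 * b * c * ((s - 1ℤ) * (s - 1ℤ) - (τ - 1ℤ) * (s - 1ℤ - τ))
      + + 2 * s * c * ((b - 1ℤ) * (b - 1ℤ) - β * (b - 1ℤ - β - + 2))
      + + 2 * s * b * (α * (c - 1ℤ - α + + 2))
      + s * b * c * (1ℤ - e + (e′ - - 1ℤ))
    split = solve-∀

  formula≥ : + 4 * (num₂ (b + s) s n + numᵈ (b + s) s) ≤ formula s b (n + σ) τ β α e e′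
  formula≥ = ℤ.0≤i-j⇒j≤i (subst (0ℤ ≤_) (sym (split s b n τ β α e e′))
    (subst₂ (λ s b → 0ℤ ≤ lower-margin s b) (sym s≡) (sym b≡) (0≤lower-margin 0≤x 0≤y)
      ⊕ 0≤+ 4 ⊗ 0≤b ⊗ 0≤c ⊗ linear-bound 0≤τ 0≤τ′ hτ
      ⊕ 0≤+ 2 ⊗ 0≤s ⊗ 0≤c ⊗ linear-bound′ 0≤β 0≤β′ hβ
      ⊕ 0≤+ 2 ⊗ 0≤s ⊗ 0≤b ⊗ product-square-bound 0≤α 0≤α′ hα
      ⊕ 0≤s ⊗ 0≤b ⊗ 0≤c ⊗ (0≤e+1 ⊕ 0≤1-e′)))
    where
    split : ∀ s b n τ β α e e′ →
      let c = b + + 2 * s ; r = b + s ; k = n + (+ 2 * b + + 3 * s) in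
      (+ 4 * k * (k - (+ 2 * b + + 3 * s)) + + 8 * (s * b * c) + + 4 * b * c * (τ - 1ℤ) * (s - 1ℤ - τ)
      + + 2 * s * c * β * (b - 1ℤ - β - + 2) - + 2 * s * b * α * (c - 1ℤ - α + + 2) + s * b * c * (e - e′))
      - + 4 * ((n * (n * 1ℤ)) + + 2 * n * r + n * s + + 2 * r + s - 1ℤ
      + ((r * (r * (r * 1ℤ))) * (- (+ 2 * (s * (s * 1ℤ))) - s) + + 2 * (r * (r * 1ℤ)) * (s * (s * (s * 1ℤ)))
      + r * (+ 2 * (s * (s * (s * (s * 1ℤ)))) + (s * (s * (s * 1ℤ))) + + 2 * s - 1ℤ)
      - + 2 * (s * (s * (s * (s * (s * 1ℤ))))) - + 2 * (s * (s * 1ℤ)) - s + 1ℤ))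
      ≡ + 6 * (s * b * c) - + 4 * b * c * (s - 1ℤ) - + 4 * s * c * (b - 1ℤ) - + 2 * s * b * ((c - 1ℤ) * (c - 1ℤ) + + 2 * (c - 1ℤ))
      - + 4 * (+ 2 * r + s - 1ℤ + ((r * (r * (r * 1ℤ))) * (- (+ 2 * (s * (s * 1ℤ))) - s) + + 2 * (r * (r * 1ℤ)) * (s * (s * (s * 1ℤ)))
      + r * (+ 2 * (s * (s * (s * (s * 1ℤ)))) + (s * (s * (s * 1ℤ))) + + 2 * s - 1ℤ)
      - + 2 * (s * (s * (s * (s * (s * 1ℤ))))) - + 2 * (s * (s * 1ℤ)) - s + 1ℤ))
      + + 4 * b * c * ((τ - 1ℤ) * (s - 1ℤ - τ) + (s - 1ℤ))
      + + 2 * s * c * (β * (b - 1ℤ - β - + 2) + + 2 * (b - 1ℤ))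
      + + 2 * s * b * ((c - 1ℤ) * (c - 1ℤ) + + 2 * (c - 1ℤ) - α * (c - 1ℤ - α + + 2))
      + s * b * c * (e - - 1ℤ + (1ℤ - e′))
    split = solve-∀

-- Iterated differences

∂ : ℕ → Series → Series
∂ e f k = f (k ℕ.+ e) - f k

∂³ : (a b c : ℕ) → Series → Series
∂³ a b c f = ∂ c (∂ b (∂ a f))

∂-cong : ∀ e {f g} → f ≗ g → ∂ e f ≗ ∂ e g
∂-cong e f≗g k = cong₂ _-_ (f≗g (k ℕ.+ e)) (f≗g k)

∂³-cong : ∀ a b c {f g} → f ≗ g → ∂³ a b c f ≗ ∂³ a b c g
∂³-cong a b c f≗g = ∂-cong c (∂-cong b (∂-cong a f≗g))

∂-+ : ∀ e f g → ∂ e (λ k → f k + g k) ≗ λ k → ∂ e f k + ∂ e g k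
∂-+ e f g k = regroup (f (k ℕ.+ e)) (g (k ℕ.+ e)) (f k) (g k)
  where
  regroup : ∀ w x y z → (w + x) - (y + z) ≡ (w - y) + (x - z)
  regroup = solve-∀

∂³-+ : ∀ a b c f g → ∂³ a b c (λ k → f k + g k) ≗ λ k → ∂³ a b c f k + ∂³ a b c g k
∂³-+ a b c f g k = trans
  (∂-cong c (λ j → trans (∂-cong b (∂-+ a f g) j) (∂-+ b (∂ a f) (∂ a g) j)) k)
  (∂-+ c (∂ b (∂ a f)) (∂ b (∂ a g)) k)

∂-*ˡ : ∀ e d f → ∂ e (λ k → d * f k) ≗ λ k → d * ∂ e f k
∂-*ˡ e d f k = factor d (f (k ℕ.+ e)) (f k)
  where
  factor : ∀ d x y → d * x - d * y ≡ d * (x - y)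
  factor = solve-∀

∂³-*ˡ : ∀ a b c d f → ∂³ a b c (λ k → d * f k) ≗ λ k → d * ∂³ a b c f k
∂³-*ˡ a b c d f k = trans
  (∂-cong c (λ j → trans (∂-cong b (∂-*ˡ a d f) j) (∂-*ˡ b d (∂ a f) j)) k)
  (∂-*ˡ c d (∂ b (∂ a f)) k)

Periodic : ℕ → Series → Set
Periodic e f = ∀ k → f (k ℕ.+ e) ≡ f k

∂-periodic : ∀ {e f} d → Periodic e f → Periodic e (∂ d f)
∂-periodic {e} {f} d per k = cong₂ _-_ (trans (cong f (swap k e d)) (per (k ℕ.+ d))) (per k)
  where
  swap : ∀ k e d → k ℕ.+ e ℕ.+ d ≡ k ℕ.+ d ℕ.+ e
  swap = ℕ-Solver.solve-∀

∂-kills : ∀ {e f} → Periodic e f → ∂ e f ≗ λ _ → 0ℤ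
∂-kills per k = zeroed (per k)

∂³-killsᵃ : ∀ {a f} b c → Periodic a f → ∂³ a b c f ≗ λ _ → 0ℤ
∂³-killsᵃ b c per = ∂-cong c (∂-cong b (∂-kills per))

∂³-killsᵇ : ∀ {b f} a c → Periodic b f → ∂³ a b c f ≗ λ _ → 0ℤ
∂³-killsᵇ a c per = ∂-cong c (∂-kills (∂-periodic a per))

∂³-killsᶜ : ∀ {c f} a b → Periodic c f → ∂³ a b c f ≗ λ _ → 0ℤ
∂³-killsᶜ a b per = ∂-kills (∂-periodic b (∂-periodic a per))

∂³-quadratic : ∀ a b c σ d → ∂³ a b c (λ k → + 4 * + k * (+ k - σ) + d) ≗ λ _ → 0ℤ
∂³-quadratic a b c σ d k = vanish (+ k) (+ a) (+ b) (+ c) σ d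
  where
  vanish : ∀ k a b c σ d →
    let q₀ = + 4 * k * (k - σ) + d
        q₁ = + 4 * (k + a) * (k + a - σ) + d
        q₂ = + 4 * (k + b) * (k + b - σ) + d
        q₃ = + 4 * (k + b + a) * (k + b + a - σ) + d
        q₄ = + 4 * (k + c) * (k + c - σ) + d
        q₅ = + 4 * (k + c + a) * (k + c + a - σ) + d
        q₆ = + 4 * (k + c + b) * (k + c + b - σ) + d
        q₇ = + 4 * (k + c + b + a) * (k + c + b + a - σ) + d in
    q₇ - q₆ - (q₅ - q₄) - (q₃ - q₂ - (q₁ - q₀)) ≡ 0ℤ
  vanish = solve-∀

∂-shift : ∀ e d f → ∂ e (shift (e ℕ.+ d) f) ≗ shift d (f ⊖ shift e f)
∂-shift e d f k = begin
  shift (e ℕ.+ d) f (k ℕ.+ e) - shift (e ℕ.+ d) f k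
    ≡⟨ cong₂ _-_ (trans (cong (shift (e ℕ.+ d) f) (ℕ.+-comm k e)) (shift-+ e d f k))
                 (trans (cong (λ i → shift i f k) (ℕ.+-comm e d)) (sym (shift-shift d e f k))) ⟩
  shift d f k - shift d (shift e f) k
    ≡⟨ shift-⊖ d f (shift e f) k ⟨
  shift d (f ⊖ shift e f) k ∎
  where open ≡-Reasoning

∂³-shift : ∀ a b c f → ∂³ a b c (shift (a ℕ.+ (b ℕ.+ c)) f) ≗ triple a b c f
∂³-shift a b c f k = begin
  ∂³ a b c (shift (a ℕ.+ (b ℕ.+ c)) f) k
    ≡⟨ ∂-cong c (λ j → trans (∂-cong b (∂-shift a (b ℕ.+ c) f) j) (∂-shift b c _ j)) k ⟩
  ∂ c (shift c h) k
    ≡⟨ ∂-cong c (λ j → cong (λ i → shift i h j) (sym (ℕ.+-identityʳ c))) k ⟩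
  ∂ c (shift (c ℕ.+ 0) h) k
    ≡⟨ ∂-shift c 0 h k ⟩
  triple a b c f k ∎
  where
  open ≡-Reasoning
  h : Series
  h = (f ⊖ shift a f) ⊖ shift b (f ⊖ shift a f)

VanishesUpTo : ℕ → Series → Set
VanishesUpTo e f = ∀ k → k ℕ.< e → f (suc k) ≡ 0ℤ

∂-vanishes : ∀ e d f → VanishesUpTo (e ℕ.+ d) f → VanishesUpTo d (∂ e f)
∂-vanishes e d f van k k<d =
  cong₂ _-_ (van (k ℕ.+ e) (subst (ℕ._< e ℕ.+ d) (ℕ.+-comm e k) (ℕ.+-monoʳ-< e k<d)))
            (van k (ℕ.<-≤-trans k<d (ℕ.m≤n+m d e)))

vanishes : ∀ e f .{{_ : NonZero e}} → VanishesUpTo e f → (∀ k → ∂ e f (suc k) ≡ 0ℤ) → ∀ k → f (suc k) ≡ 0ℤ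
vanishes e@(suc e-1) f van ∂f≡0 k = go (suc k) k ℕ.≤-refl
  where
  go : ∀ n k → k ℕ.< n → f (suc k) ≡ 0ℤ
  go (suc n) k (ℕ.s≤s k≤n) with k ℕ.<? e
  ... | yes k<e = van k k<e
  ... | no  k≮e = begin
    f (suc k)               ≡⟨ cong (λ j → f (suc j)) (ℕ.m∸n+n≡m e≤k) ⟨
    f (suc (k ℕ.∸ e) ℕ.+ e) ≡⟨ ℤ.i-j≡0⇒i≡j _ _ (∂f≡0 (k ℕ.∸ e)) ⟩
    f (suc (k ℕ.∸ e))       ≡⟨ go n (k ℕ.∸ e) (ℕ.<-≤-trans (ℕ.∸-monoʳ-< (ℕ.s≤s ℕ.z≤n) e≤k) k≤n) ⟩
    0ℤ                      ∎
    where
    open ≡-Reasoning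
    e≤k : e ℕ.≤ k
    e≤k = ℕ.≮⇒≥ k≮e

∂³-vanishes : ∀ a b c f .{{_ : NonZero a}} .{{_ : NonZero b}} .{{_ : NonZero c}} →
  VanishesUpTo (a ℕ.+ (b ℕ.+ c)) f → (∀ k → ∂³ a b c f (suc k) ≡ 0ℤ) → ∀ k → f (suc k) ≡ 0ℤ
∂³-vanishes a b c f van ∂³f≡0 =
  vanishes a f (λ k k<a → van k (ℕ.<-≤-trans k<a (ℕ.m≤m+n a _)))
    (vanishes b (∂ a f) (λ k k<b → vanᵃ k (ℕ.<-≤-trans k<b (ℕ.m≤m+n b c)))
      (vanishes c (∂ b (∂ a f)) (∂-vanishes b c (∂ a f) vanᵃ) ∂³f≡0))
  where
  vanᵃ : VanishesUpTo (b ℕ.+ c) (∂ a f)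
  vanᵃ = ∂-vanishes a (b ℕ.+ c) f van

coprime⇒inverse : ∀ i m .{{_ : NonZero i}} .{{_ : NonZero m}} → Coprime i m →
  ∃ λ x → ∃ λ y → x ℕ.* i ≡ 1 ℕ.+ y ℕ.* m
coprime⇒inverse i@(suc i′) m@(suc m′) coprime with coprime-Bézout coprime
... | GCD.Bézout.Identity.+- x y eq = x , y , sym eq
... | GCD.Bézout.Identity.-+ x y eq = x ℕ.* m′ ℕ.+ m , y ℕ.* m′ ℕ.+ i′ ,
  ℕ.+-cancelʳ-≡ m′ _ _ (trans (left x i′ m′) (trans (cong (λ z → m′ ℕ.* z ℕ.+ suc m′ ℕ.* suc i′) eq) (right y i′ m′)))
  where
  left : ∀ x i′ m′ → (x ℕ.* m′ ℕ.+ suc m′) ℕ.* suc i′ ℕ.+ m′ ≡ m′ ℕ.* (1 ℕ.+ x ℕ.* suc i′) ℕ.+ suc m′ ℕ.* suc i′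
  left = ℕ-Solver.solve-∀
  right : ∀ y i′ m′ → m′ ℕ.* (y ℕ.* suc m′) ℕ.+ suc m′ ℕ.* suc i′ ≡ 1 ℕ.+ (y ℕ.* m′ ℕ.+ i′) ℕ.* suc m′ ℕ.+ m′
  right = ℕ-Solver.solve-∀

residue : (i o m : ℕ) .{{_ : NonZero m}} → ℕ → ℕ
residue i o m k = (i ℕ.* k ℕ.+ o) ℕ.% m

residue-periodic : ∀ i o m .{{_ : NonZero m}} k → residue i o m (k ℕ.+ m) ≡ residue i o m k
residue-periodic i o m k = trans (cong (ℕ._% m) (arith i o m k)) (ℕ.[m+kn]%n≡m%n (i ℕ.* k ℕ.+ o) i m)
  where
  arith : ∀ i o m k → i ℕ.* (k ℕ.+ m) ℕ.+ o ≡ i ℕ.* k ℕ.+ o ℕ.+ i ℕ.* m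
  arith = ℕ-Solver.solve-∀

complement : (i o m : ℕ) .{{_ : NonZero m}} → ℕ → ℕ
complement i o m k = m ℕ.∸ suc (residue i o m k)

residue+complement : ∀ i o m .{{_ : NonZero m}} k → residue i o m k ℕ.+ complement i o m k ℕ.+ 1 ≡ m
residue+complement i o m k =
  trans (ℕ.+-comm _ 1) (ℕ.m+[n∸m]≡n (ℕ.m%n<n (i ℕ.* k ℕ.+ o) m))

residue-quotient : ∀ i o m .{{_ : NonZero m}} k →
  + i * + k + + o ≡ + residue i o m k + + ((i ℕ.* k ℕ.+ o) ℕ./ m) * + m
residue-quotient i o m k = begin
  + i * + k + + o                          ≡⟨ cong (_+ + o) (ℤ.pos-* i k) ⟨
  + (i ℕ.* k ℕ.+ o)                        ≡⟨ cong +_ (ℕ.m≡m%n+[m/n]*n (i ℕ.* k ℕ.+ o) m) ⟩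
  + residue i o m k + + (q ℕ.* m)          ≡⟨ cong (_+_ (+ residue i o m k)) (ℤ.pos-* q m) ⟩
  + residue i o m k + + q * + m            ∎
  where
  open ≡-Reasoning
  q : ℕ
  q = (i ℕ.* k ℕ.+ o) ℕ./ m

module _
  {s b iᵃ jᵃ qᵃ τ iᵇ jᵇ qᵇ β iᶜ jᶜ qᶜ α k : ℤ}
  (inverseᵃ : iᵃ * (b + s) ≡ 1ℤ + jᵃ * s) (divᵃ : iᵃ * k + (s - 1ℤ) ≡ τ + qᵃ * s)
  (inverseᵇ : iᵇ * s ≡ 1ℤ + jᵇ * b) (divᵇ : iᵇ * k + (b - + 3) ≡ β + qᵇ * b)
  (inverseᶜ : iᶜ * s ≡ 1ℤ + jᶜ * (b + + 2 * s)) (divᶜ : iᶜ * k + 1ℤ ≡ α + qᶜ * (b + + 2 * s))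
  where

  coordinates : ∃ λ u → ∃ λ K → ∃ λ L →
    k ≡ (b + s) * (τ + 1ℤ) + s * (u + 1ℤ) × u + τ - 1ℤ ≡ b * L + β × u - τ + 1ℤ ≡ (b + + 2 * s) * K + α
  coordinates = u , K , L , k≡ , v≡ , w≡
    where
    u = (b + s) * qᵃ - (b + s) - jᵃ * k - 1ℤ
    L = iᵇ * (s * qᵇ - s - jᵇ * k - τ - 1ℤ) - jᵇ * (u + τ - 1ℤ - β)
    K = iᶜ * (s * qᶜ - jᶜ * k - τ - 1ℤ) - jᶜ * (u - τ + 1ℤ - α)

    k≡ : k ≡ (b + s) * (τ + 1ℤ) + s * (u + 1ℤ)
    k≡ = by-combination (- k ⊠ zeroed inverseᵃ ⊞ (b + s) ⊠ zeroed divᵃ) (id s b iᵃ jᵃ qᵃ τ k)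
      where
      id : ∀ s b iᵃ jᵃ qᵃ τ k → let u = (b + s) * qᵃ - (b + s) - jᵃ * k - 1ℤ in
        k - ((b + s) * (τ + 1ℤ) + s * (u + 1ℤ))
        ≡ - k * (iᵃ * (b + s) - (1ℤ + jᵃ * s)) + (b + s) * (iᵃ * k + (s - 1ℤ) - (τ + qᵃ * s))
      id = solve-∀

    v≡ : u + τ - 1ℤ ≡ b * L + β
    v≡ = by-combination
      (- iᵇ ⊠ zeroed k≡ ⊞ (- (iᵇ * k) - (u + τ - 1ℤ - β)) ⊠ zeroed inverseᵇ ⊞ iᵇ * s ⊠ zeroed divᵇ)
      (id s b u iᵇ jᵇ qᵇ τ β k)
      where
      id : ∀ s b u iᵇ jᵇ qᵇ τ β k →
        let L = iᵇ * (s * qᵇ - s - jᵇ * k - τ - 1ℤ) - jᵇ * (u + τ - 1ℤ - β) in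
        u + τ - 1ℤ - (b * L + β)
        ≡ - iᵇ * (k - ((b + s) * (τ + 1ℤ) + s * (u + 1ℤ)))
          + (- (iᵇ * k) - (u + τ - 1ℤ - β)) * (iᵇ * s - (1ℤ + jᵇ * b))
          + iᵇ * s * (iᵇ * k + (b - + 3) - (β + qᵇ * b))
      id = solve-∀

    w≡ : u - τ + 1ℤ ≡ (b + + 2 * s) * K + α
    w≡ = by-combination
      (- iᶜ ⊠ zeroed k≡ ⊞ (- (iᶜ * k) - (u - τ + 1ℤ - α)) ⊠ zeroed inverseᶜ ⊞ iᶜ * s ⊠ zeroed divᶜ)
      (id s b u iᶜ jᶜ qᶜ τ α k)
      where
      id : ∀ s b u iᶜ jᶜ qᶜ τ α k →
        let c = b + + 2 * s ; K = iᶜ * (s * qᶜ - jᶜ * k - τ - 1ℤ) - jᶜ * (u - τ + 1ℤ - α) in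
        u - τ + 1ℤ - (c * K + α)
        ≡ - iᶜ * (k - ((b + s) * (τ + 1ℤ) + s * (u + 1ℤ)))
          + (- (iᶜ * k) - (u - τ + 1ℤ - α)) * (iᶜ * s - (1ℤ + jᶜ * c))
          + iᶜ * s * (iᶜ * k + 1ℤ - (α + qᶜ * c))
      id = solve-∀

-- The coprimality of s, b, c gives s = 2 + 2m and b = 3 + 2m + 2x, and the inverses iᵃ, iᵇ, iᶜ turn
-- the remainders of t + 1, v and w into explicit periodic functions of k.
module Parametrised
  (m x s b c : ℕ) .{{s≢0 : NonZero s}} .{{b≢0 : NonZero b}} .{{c≢0 : NonZero c}}
  (s≡ : s ≡ 2 ℕ.+ 2 ℕ.* m) (b≡ : b ≡ 3 ℕ.+ 2 ℕ.* m ℕ.+ 2 ℕ.* x) (c≡ : c ≡ b ℕ.+ 2 ℕ.* s)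
  (iᵃ jᵃ iᵇ jᵇ iᶜ jᶜ : ℕ)
  (inverseᵃ : iᵃ ℕ.* (b ℕ.+ s) ≡ 1 ℕ.+ jᵃ ℕ.* s)
  (inverseᵇ : iᵇ ℕ.* s ≡ 1 ℕ.+ jᵇ ℕ.* b)
  (inverseᶜ : iᶜ ℕ.* s ≡ 1 ℕ.+ jᶜ ℕ.* c)
  where

  σ : ℕ
  σ = s ℕ.+ (b ℕ.+ c)

  S B C Σ D : ℤ
  S = + 2 + + 2 * + m
  B = + 3 + + 2 * + m + + 2 * + x
  C = B + + 2 * S
  Σ = + 2 * B + + 3 * S
  D = S * B * C

  +s≡S : + s ≡ S
  +s≡S = trans (cong +_ s≡) (cong (_+_ (+ 2)) (ℤ.pos-* 2 m))

  +b≡B : + b ≡ B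
  +b≡B = trans (cong +_ b≡) (cong₂ (λ y z → + 3 + y + z) (ℤ.pos-* 2 m) (ℤ.pos-* 2 x))

  +c≡C : + c ≡ C
  +c≡C = trans (cong +_ c≡) (cong₂ _+_ +b≡B (trans (ℤ.pos-* 2 s) (cong (+ 2 *_) +s≡S)))

  +σ≡Σ : + σ ≡ Σ
  +σ≡Σ = trans (cong₂ _+_ +s≡S (cong₂ _+_ +b≡B +c≡C)) (arith S B)
    where
    arith : ∀ s b → s + (b + (b + + 2 * s)) ≡ + 2 * b + + 3 * s
    arith = solve-∀

  offsetᵃ offsetᵇ : ℕ
  offsetᵃ = 1 ℕ.+ 2 ℕ.* m
  offsetᵇ = 2 ℕ.* m ℕ.+ 2 ℕ.* x

  0≤S-2 : 0ℤ ≤ S - + 2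
  0≤S-2 = subst (0ℤ ≤_) (arith (+ m)) (0≤+ 2 ⊗ 0≤+ m)
    where
    arith : ∀ m → + 2 * m ≡ + 2 + + 2 * m - + 2
    arith = solve-∀

  0≤B-3 : 0ℤ ≤ B - + 3
  0≤B-3 = subst (0ℤ ≤_) (arith (+ m) (+ x)) (0≤+ 2 ⊗ 0≤+ m ⊕ 0≤+ 2 ⊗ 0≤+ x)
    where
    arith : ∀ m x → + 2 * m + + 2 * x ≡ + 3 + + 2 * m + + 2 * x - + 3
    arith = solve-∀

  τ τ′ β β′ α α′ : ℕ → ℕ
  τ  = residue    iᵃ offsetᵃ s
  τ′ = complement iᵃ offsetᵃ s
  β  = residue    iᵇ offsetᵇ b
  β′ = complement iᵇ offsetᵇ b
  α  = residue    iᶜ 1 c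
  α′ = complement iᶜ 1 c

  hτ : ∀ k → + τ k + + τ′ k + 1ℤ ≡ S
  hτ k = trans (cong +_ (residue+complement iᵃ offsetᵃ s k)) +s≡S

  hβ : ∀ k → + β k + + β′ k + 1ℤ ≡ B
  hβ k = trans (cong +_ (residue+complement iᵇ offsetᵇ b k)) +b≡B

  hα : ∀ k → + α k + + α′ k + 1ℤ ≡ C
  hα k = trans (cong +_ (residue+complement iᶜ 1 c k)) +c≡C

  sgnβ≡sgnβ′ : ∀ k → sgn (β k) ≡ sgn (β′ k)
  sgnβ≡sgnβ′ k = sgn-sum-even (β k) (β′ k) (1 ℕ.+ m ℕ.+ x)
    (ℕ.+-cancelʳ-≡ 1 _ _ (trans (residue+complement iᵇ offsetᵇ b k) (trans b≡ (arith m x))))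
    where
    arith : ∀ m x → 3 ℕ.+ 2 ℕ.* m ℕ.+ 2 ℕ.* x ≡ (1 ℕ.+ m ℕ.+ x) ℕ.+ (1 ℕ.+ m ℕ.+ x) ℕ.+ 1
    arith = ℕ-Solver.solve-∀

  sgnα≡sgnα′ : ∀ k → sgn (α k) ≡ sgn (α′ k)
  sgnα≡sgnα′ k = sgn-sum-even (α k) (α′ k) (3 ℕ.+ 3 ℕ.* m ℕ.+ x)
    (ℕ.+-cancelʳ-≡ 1 _ _ (trans (residue+complement iᶜ 1 c k) (trans c≡ (trans (cong₂ (λ y z → y ℕ.+ 2 ℕ.* z) b≡ s≡) (arith m x)))))
    where
    arith : ∀ m x → 3 ℕ.+ 2 ℕ.* m ℕ.+ 2 ℕ.* x ℕ.+ 2 ℕ.* (2 ℕ.+ 2 ℕ.* m)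
      ≡ (3 ℕ.+ 3 ℕ.* m ℕ.+ x) ℕ.+ (3 ℕ.+ 3 ℕ.* m ℕ.+ x) ℕ.+ 1
    arith = ℕ-Solver.solve-∀

  cast-inverse : ∀ i n j l {N L} → + n ≡ N → + l ≡ L → i ℕ.* n ≡ 1 ℕ.+ j ℕ.* l → + i * N ≡ 1ℤ + + j * L
  cast-inverse i n j l refl refl eq =
    trans (sym (ℤ.pos-* i n)) (trans (cong +_ eq) (cong (_+_ 1ℤ) (ℤ.pos-* j l)))

  cast-division : ∀ i o n .{{_ : NonZero n}} k {O N} → + o ≡ O → + n ≡ N →
    + i * + k + O ≡ + residue i o n k + + ((i ℕ.* k ℕ.+ o) ℕ./ n) * N
  cast-division i o n k refl refl = residue-quotient i o n k

  offsetᵃ≡S-1 : + offsetᵃ ≡ S - 1ℤ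
  offsetᵃ≡S-1 = trans (cong (_+_ 1ℤ) (ℤ.pos-* 2 m)) (arith (+ 2 * + m))
    where
    arith : ∀ y → 1ℤ + y ≡ + 2 + y - 1ℤ
    arith = solve-∀

  offsetᵇ≡B-3 : + offsetᵇ ≡ B - + 3
  offsetᵇ≡B-3 = trans (cong₂ _+_ (ℤ.pos-* 2 m) (ℤ.pos-* 2 x)) (arith (+ 2 * + m) (+ 2 * + x))
    where
    arith : ∀ y z → y + z ≡ + 3 + y + z - + 3
    arith = solve-∀

  F : Series
  F k = formula S B (+ k) (+ τ k) (+ β k) (+ α k) (sgn (β k)) (sgn (α k))

  F-window : ∀ j → suc j ℕ.< σ → F (suc j) ≡ 0ℤ
  F-window j 1+j<σ = from-coordinates (coordinates
    {S} {B} {+ iᵃ} {+ jᵃ} {+ qᵃ} {+ τ k} {+ iᵇ} {+ jᵇ} {+ qᵇ} {+ β k} {+ iᶜ} {+ jᶜ} {+ qᶜ} {+ α k} {+ k}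
    (cast-inverse iᵃ (b ℕ.+ s) jᵃ s (cong₂ _+_ +b≡B +s≡S) +s≡S inverseᵃ)
    (cast-division iᵃ offsetᵃ s k offsetᵃ≡S-1 +s≡S)
    (cast-inverse iᵇ s jᵇ b +s≡S +b≡B inverseᵇ)
    (cast-division iᵇ offsetᵇ b k offsetᵇ≡B-3 +b≡B)
    (cast-inverse iᶜ s jᶜ c +s≡S +c≡C inverseᶜ)
    (cast-division iᶜ 1 c k refl +c≡C))
    where
    k : ℕ
    k = suc j
    qᵃ qᵇ qᶜ : ℕ
    qᵃ = (iᵃ ℕ.* k ℕ.+ offsetᵃ) ℕ./ s
    qᵇ = (iᵇ ℕ.* k ℕ.+ offsetᵇ) ℕ./ b
    qᶜ = (iᶜ ℕ.* k ℕ.+ 1) ℕ./ c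

    from-coordinates : (∃ λ u → ∃ λ K → ∃ λ L →
      + k ≡ (B + S) * (+ τ k + 1ℤ) + S * (u + 1ℤ)
      × u + + τ k - 1ℤ ≡ B * L + + β k × u - + τ k + 1ℤ ≡ C * K + + α k) → F k ≡ 0ℤ
    from-coordinates (u , K , L , k≡ , v≡ , w≡) =
      formula≡0 {S} {B} 0≤S-2 0≤B-3 (τ k) (τ′ k) (β k) (β′ k) (α k) (α′ k) j (σ ℕ.∸ suc k)
        (hτ k) (hβ k) (hα k) refl
        (trans (cong +_ (trans (ℕ.+-suc k _) (ℕ.m+[n∸m]≡n 1+j<σ))) +σ≡Σ)
        (sgnβ≡sgnβ′ k) (sgnα≡sgnα′ k) u K L k≡ v≡ w≡

  τσ≡1 : τ σ ≡ 1
  τσ≡1 = begin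
    (iᵃ ℕ.* σ ℕ.+ offsetᵃ) ℕ.% s
      ≡⟨ cong (ℕ._% s) (trans (cong (λ z → iᵃ ℕ.* (s ℕ.+ (b ℕ.+ z)) ℕ.+ offsetᵃ) c≡) (trans (collect iᵃ s b m) (cong (λ z → 2 ℕ.* z ℕ.+ iᵃ ℕ.* s ℕ.+ offsetᵃ) inverseᵃ))) ⟩
    (2 ℕ.* (1 ℕ.+ jᵃ ℕ.* s) ℕ.+ iᵃ ℕ.* s ℕ.+ offsetᵃ) ℕ.% s
      ≡⟨ cong (ℕ._% s) (factor s≡) ⟩
    (1 ℕ.+ (1 ℕ.+ 2 ℕ.* jᵃ ℕ.+ iᵃ) ℕ.* s) ℕ.% s
      ≡⟨ ℕ.[m+kn]%n≡m%n 1 (1 ℕ.+ 2 ℕ.* jᵃ ℕ.+ iᵃ) s ⟩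
    1 ℕ.% s
      ≡⟨ ℕ.m<n⇒m%n≡m (subst (1 ℕ.<_) (sym s≡) (ℕ.s≤s (ℕ.s≤s ℕ.z≤n))) ⟩
    1 ∎
    where
    open ≡-Reasoning
    collect : ∀ i s b m → i ℕ.* (s ℕ.+ (b ℕ.+ (b ℕ.+ 2 ℕ.* s))) ℕ.+ (1 ℕ.+ 2 ℕ.* m)
      ≡ 2 ℕ.* (i ℕ.* (b ℕ.+ s)) ℕ.+ i ℕ.* s ℕ.+ (1 ℕ.+ 2 ℕ.* m)
    collect = ℕ-Solver.solve-∀
    expand : ∀ i j m → let s = 2 ℕ.+ 2 ℕ.* m in
      2 ℕ.* (1 ℕ.+ j ℕ.* s) ℕ.+ i ℕ.* s ℕ.+ (1 ℕ.+ 2 ℕ.* m) ≡ 1 ℕ.+ (1 ℕ.+ 2 ℕ.* j ℕ.+ i) ℕ.* s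
    expand = ℕ-Solver.solve-∀
    factor : ∀ {s} → s ≡ 2 ℕ.+ 2 ℕ.* m →
      2 ℕ.* (1 ℕ.+ jᵃ ℕ.* s) ℕ.+ iᵃ ℕ.* s ℕ.+ offsetᵃ ≡ 1 ℕ.+ (1 ℕ.+ 2 ℕ.* jᵃ ℕ.+ iᵃ) ℕ.* s
    factor refl = expand iᵃ jᵃ m

  βσ≡0 : β σ ≡ 0
  βσ≡0 = begin
    (iᵇ ℕ.* σ ℕ.+ offsetᵇ) ℕ.% b
      ≡⟨ cong (ℕ._% b) (trans (cong (λ z → iᵇ ℕ.* (s ℕ.+ (b ℕ.+ z)) ℕ.+ offsetᵇ) c≡) (trans (collect iᵇ s b offsetᵇ) (cong (λ z → 3 ℕ.* z ℕ.+ 2 ℕ.* iᵇ ℕ.* b ℕ.+ offsetᵇ) inverseᵇ))) ⟩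
    (3 ℕ.* (1 ℕ.+ jᵇ ℕ.* b) ℕ.+ 2 ℕ.* iᵇ ℕ.* b ℕ.+ offsetᵇ) ℕ.% b
      ≡⟨ cong (ℕ._% b) (factor b≡) ⟩
    (1 ℕ.+ 3 ℕ.* jᵇ ℕ.+ 2 ℕ.* iᵇ) ℕ.* b ℕ.% b
      ≡⟨ ℕ.m*n%n≡0 (1 ℕ.+ 3 ℕ.* jᵇ ℕ.+ 2 ℕ.* iᵇ) b ⟩
    0 ∎
    where
    open ≡-Reasoning
    collect : ∀ i s b o → i ℕ.* (s ℕ.+ (b ℕ.+ (b ℕ.+ 2 ℕ.* s))) ℕ.+ o
      ≡ 3 ℕ.* (i ℕ.* s) ℕ.+ 2 ℕ.* i ℕ.* b ℕ.+ o
    collect = ℕ-Solver.solve-∀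
    expand : ∀ i j m x → let b = 3 ℕ.+ 2 ℕ.* m ℕ.+ 2 ℕ.* x in
      3 ℕ.* (1 ℕ.+ j ℕ.* b) ℕ.+ 2 ℕ.* i ℕ.* b ℕ.+ (2 ℕ.* m ℕ.+ 2 ℕ.* x) ≡ (1 ℕ.+ 3 ℕ.* j ℕ.+ 2 ℕ.* i) ℕ.* b
    expand = ℕ-Solver.solve-∀
    factor : ∀ {b} → b ≡ 3 ℕ.+ 2 ℕ.* m ℕ.+ 2 ℕ.* x →
      3 ℕ.* (1 ℕ.+ jᵇ ℕ.* b) ℕ.+ 2 ℕ.* iᵇ ℕ.* b ℕ.+ offsetᵇ ≡ (1 ℕ.+ 3 ℕ.* jᵇ ℕ.+ 2 ℕ.* iᵇ) ℕ.* b
    factor refl = expand iᵇ jᵇ m x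

  ασ≡0 : α σ ≡ 0
  ασ≡0 = begin
    (iᶜ ℕ.* σ ℕ.+ 1) ℕ.% c
      ≡⟨ ℕ.[m+kn]%n≡m%n (iᶜ ℕ.* σ ℕ.+ 1) jᶜ c ⟨
    (iᶜ ℕ.* σ ℕ.+ 1 ℕ.+ jᶜ ℕ.* c) ℕ.% c
      ≡⟨ cong (ℕ._% c) (trans (ℕ.+-assoc (iᶜ ℕ.* σ) 1 _) (cong (iᶜ ℕ.* σ ℕ.+_) (sym inverseᶜ))) ⟩
    (iᶜ ℕ.* σ ℕ.+ iᶜ ℕ.* s) ℕ.% c
      ≡⟨ cong (ℕ._% c) (factor c≡) ⟩
    2 ℕ.* iᶜ ℕ.* c ℕ.% c
      ≡⟨ ℕ.m*n%n≡0 (2 ℕ.* iᶜ) c ⟩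
    0 ∎
    where
    open ≡-Reasoning
    expand : ∀ i s b → i ℕ.* (s ℕ.+ (b ℕ.+ (b ℕ.+ 2 ℕ.* s))) ℕ.+ i ℕ.* s ≡ 2 ℕ.* i ℕ.* (b ℕ.+ 2 ℕ.* s)
    expand = ℕ-Solver.solve-∀
    factor : ∀ {c} → c ≡ b ℕ.+ 2 ℕ.* s → iᶜ ℕ.* (s ℕ.+ (b ℕ.+ c)) ℕ.+ iᶜ ℕ.* s ≡ 2 ℕ.* iᶜ ℕ.* c
    factor refl = expand iᶜ s b

  Fσ≡8D : F σ ≡ + 8 * D
  Fσ≡8D = begin
    F σ
      ≡⟨ cong₂ (λ t z → formula S B z (+ t) (+ β σ) (+ α σ) (sgn (β σ)) (sgn (α σ))) τσ≡1 +σ≡Σ ⟩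
    formula S B Σ 1ℤ (+ β σ) (+ α σ) (sgn (β σ)) (sgn (α σ))
      ≡⟨ cong₂ (λ y z → formula S B Σ 1ℤ (+ y) (+ z) (sgn y) (sgn z)) βσ≡0 ασ≡0 ⟩
    formula S B Σ 1ℤ 0ℤ 0ℤ 1ℤ 1ℤ
      ≡⟨ evaluate S B ⟩
    + 8 * D ∎
    where
    open ≡-Reasoning
    evaluate : ∀ s b → let c = b + + 2 * s ; k = + 2 * b + + 3 * s in
      + 4 * k * (k - (+ 2 * b + + 3 * s)) + + 8 * (s * b * c) + + 4 * b * c * (1ℤ - 1ℤ) * (s - 1ℤ - 1ℤ)
      + + 2 * s * c * 0ℤ * (b - 1ℤ - 0ℤ - + 2) - + 2 * s * b * 0ℤ * (c - 1ℤ - 0ℤ + + 2) + s * b * c * (1ℤ - 1ℤ)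
      ≡ + 8 * (s * b * c)
    evaluate = solve-∀

  ∂³F≡0 : ∀ k → ∂³ s b c F k ≡ 0ℤ
  ∂³F≡0 k = begin
    ∂³ s b c F k
      ≡⟨ ∂³-cong s b c (λ k → split S B (+ k) (+ τ k) (+ β k) (+ α k) (sgn (β k)) (sgn (α k))) k ⟩
    ∂³ s b c (λ k → Q k + (f k + (g k + h k))) k
      ≡⟨ ∂³-+ s b c Q (λ k → f k + (g k + h k)) k ⟩
    ∂³ s b c Q k + ∂³ s b c (λ k → f k + (g k + h k)) k
      ≡⟨ cong (_+_ (∂³ s b c Q k)) (trans (∂³-+ s b c f (λ k → g k + h k) k)
           (cong (_+_ (∂³ s b c f k)) (∂³-+ s b c g h k))) ⟩
    ∂³ s b c Q k + (∂³ s b c f k + (∂³ s b c g k + ∂³ s b c h k))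
      ≡⟨ cong₂ _+_ (∂³-quadratic s b c Σ (+ 8 * D) k)
           (cong₂ _+_ (∂³-killsᵃ {f = f} b c (λ k → cong fᵣ (residue-periodic iᵃ offsetᵃ s k)) k)
             (cong₂ _+_ (∂³-killsᵇ {f = g} s c (λ k → cong gᵣ (residue-periodic iᵇ offsetᵇ b k)) k)
                        (∂³-killsᶜ {f = h} s b (λ k → cong hᵣ (residue-periodic iᶜ 1 c k)) k))) ⟩
    0ℤ ∎
    where
    open ≡-Reasoning
    fᵣ gᵣ hᵣ : ℕ → ℤ
    fᵣ t = + 4 * B * C * (+ t - 1ℤ) * (S - 1ℤ - + t)
    gᵣ t = + 2 * S * C * + t * (B - 1ℤ - + t - + 2) + D * sgn t
    hᵣ t = - (+ 2 * S * B * + t * (C - 1ℤ - + t + + 2)) - D * sgn t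

    Q f g h : Series
    Q k = + 4 * + k * (+ k - Σ) + + 8 * D
    f k = fᵣ (τ k)
    g k = gᵣ (β k)
    h k = hᵣ (α k)

    split : ∀ s b k τ β α e e′ → let c = b + + 2 * s in
      + 4 * k * (k - (+ 2 * b + + 3 * s)) + + 8 * (s * b * c) + + 4 * b * c * (τ - 1ℤ) * (s - 1ℤ - τ)
      + + 2 * s * c * β * (b - 1ℤ - β - + 2) - + 2 * s * b * α * (c - 1ℤ - α + + 2) + s * b * c * (e - e′)
      ≡ + 4 * k * (k - (+ 2 * b + + 3 * s)) + + 8 * (s * b * c)
        + (+ 4 * b * c * (τ - 1ℤ) * (s - 1ℤ - τ)
          + (+ 2 * s * c * β * (b - 1ℤ - β - + 2) + s * b * c * e
            + (- (+ 2 * s * b * α * (c - 1ℤ - α + + 2)) - s * b * c * e′)))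
    split = solve-∀

  module _ {p : Series} (triple-p : triple s b c p ≗ 1ₛ) where

    p₀≡1 : p 0 ≡ 1ℤ
    p₀≡1 = trans (sym triple₀) (triple-p 0)
      where
      at-0 : ∀ e .{{_ : NonZero e}} f → (f ⊖ shift e f) 0 ≡ f 0
      at-0 e f = trans (cong (_-_ (f 0)) (shift-< f (ℕ.>-nonZero⁻¹ e))) (ℤ.+-identityʳ (f 0))

      triple₀ : triple s b c p 0 ≡ p 0
      triple₀ = trans (at-0 c (g ⊖ shift b g)) (trans (at-0 b g) (at-0 s p))
        where
        g : Series
        g = p ⊖ shift s p

    error : Series
    error k = + 8 * D * shift σ p k + -1ℤ * F k

    error-window : VanishesUpTo σ error
    error-window k k<σ with suc k ℕ.≟ σ
    ... | no 1+k≢σ = cong₂ _+_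
      ((+ 8 * D) ⊠ shift-< p 1+k<σ) (-1ℤ ⊠ F-window k 1+k<σ)
      where
      1+k<σ : suc k ℕ.< σ
      1+k<σ = ℕ.≤∧≢⇒< k<σ 1+k≢σ
    ... | yes 1+k≡σ = subst (λ j → error j ≡ 0ℤ) (sym 1+k≡σ) (begin
      + 8 * D * shift σ p σ + -1ℤ * F σ
        ≡⟨ cong₂ (λ y z → + 8 * D * y + -1ℤ * z) (trans shift-σ p₀≡1) Fσ≡8D ⟩
      + 8 * D * 1ℤ + -1ℤ * (+ 8 * D)
        ≡⟨ cancel (+ 8 * D) ⟩
      0ℤ ∎)
      where
      open ≡-Reasoning
      shift-σ : shift σ p σ ≡ p 0
      shift-σ = trans (cong₂ (λ i j → shift i p j) (sym (ℕ.+-identityʳ σ)) (sym (ℕ.+-identityʳ σ))) (shift-+ σ 0 p 0)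
      cancel : ∀ y → y * 1ℤ + - 1ℤ * y ≡ 0ℤ
      cancel = solve-∀

    ∂³error≡0 : ∀ k → ∂³ s b c error (suc k) ≡ 0ℤ
    ∂³error≡0 k = begin
      ∂³ s b c error (suc k)
        ≡⟨ ∂³-+ s b c (λ k → + 8 * D * shift σ p k) (λ k → -1ℤ * F k) (suc k) ⟩
      ∂³ s b c (λ k → + 8 * D * shift σ p k) (suc k) + ∂³ s b c (λ k → -1ℤ * F k) (suc k)
        ≡⟨ cong₂ _+_ (∂³-*ˡ s b c (+ 8 * D) (shift σ p) (suc k)) (∂³-*ˡ s b c -1ℤ F (suc k)) ⟩
      + 8 * D * ∂³ s b c (shift σ p) (suc k) + -1ℤ * ∂³ s b c F (suc k)
        ≡⟨ cong₂ _+_ ((+ 8 * D) ⊠ trans (∂³-shift s b c p (suc k)) (triple-p (suc k)))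
                     (-1ℤ ⊠ ∂³F≡0 (suc k)) ⟩
      0ℤ ∎
      where open ≡-Reasoning

    error≡0 : ∀ k .{{_ : NonZero k}} → error k ≡ 0ℤ
    error≡0 (suc k) = ∂³-vanishes s b c error error-window ∂³error≡0 k

    8Dp≡F : ∀ n → + 8 * D * p n ≡ F (σ ℕ.+ n)
    8Dp≡F n = begin
      + 8 * D * p n
        ≡⟨ cong (+ 8 * D *_) (trans (cong (λ i → shift i p (σ ℕ.+ n)) (sym (ℕ.+-identityʳ σ))) (shift-+ σ 0 p n)) ⟨
      + 8 * D * shift σ p (σ ℕ.+ n)
        ≡⟨ by-combination (error≡0 (σ ℕ.+ n))
             (minus (+ 8 * D * shift σ p (σ ℕ.+ n)) (F (σ ℕ.+ n))) ⟩
      F (σ ℕ.+ n) ∎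
      where
      open ≡-Reasoning
      instance
        σ+n≢0 : NonZero (σ ℕ.+ n)
        σ+n≢0 = ℕ.>-nonZero (ℕ.<-≤-trans (ℕ.>-nonZero⁻¹ s) (ℕ.≤-trans (ℕ.m≤m+n s _) (ℕ.m≤m+n σ n)))
      minus : ∀ y z → y - z ≡ y + - 1ℤ * z
      minus = solve-∀

    8Dp≡formula : ∀ n → let k = σ ℕ.+ n in
      + 8 * D * p n ≡ formula S B (+ n + Σ) (+ τ k) (+ β k) (+ α k) (sgn (β k)) (sgn (α k))
    8Dp≡formula n = trans (8Dp≡F n)
      (cong (λ z → formula S B z (+ τ k) (+ β k) (+ α k) (sgn (β k)) (sgn (α k)))
            (trans (ℤ.+-comm (+ σ) (+ n)) (cong (_+_ (+ n)) +σ≡Σ)))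
      where
      k : ℕ
      k = σ ℕ.+ n

    bounds : ∀ n → Bounds (B + S) S (+ n) (+ 2 * D) (p n)
    bounds n =
      ℤ.*-cancelˡ-≤-pos _ _ (+ 4) (subst (_ ≤_) formula≡4p2D
        (formula≥ 0≤2x 0≤2m refl refl (0≤+ _) (0≤+ (τ′ k)) (0≤+ _) (0≤+ (β′ k)) (0≤+ _) (0≤+ (α′ k)) (hτ k) (hβ k) (hα k)
          (sgn≤1 (β k)) (-1≤sgn (β k)) (sgn≤1 (α k)) (-1≤sgn (α k)) (+ n))) ,
      ℤ.*-cancelˡ-≤-pos _ _ (+ 4) (subst (_≤ _) formula≡4p2D
        (formula≤ 0≤2x 0≤2m refl refl (0≤+ _) (0≤+ (τ′ k)) (0≤+ _) (0≤+ (β′ k)) (0≤+ _) (0≤+ (α′ k)) (hτ k) (hβ k) (hα k)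
          (sgn≤1 (β k)) (-1≤sgn (β k)) (sgn≤1 (α k)) (-1≤sgn (α k)) (+ n)))
      where
      k : ℕ
      k = σ ℕ.+ n
      0≤2m = 0≤+ 2 ⊗ 0≤+ m
      0≤2x = 0≤+ 2 ⊗ 0≤+ x
      regroup : ∀ d y → + 8 * d * y ≡ + 4 * (y * (+ 2 * d))
      regroup = solve-∀
      formula≡4p2D : formula S B (+ n + Σ) (+ τ k) (+ β k) (+ α k) (sgn (β k)) (sgn (α k)) ≡ + 4 * (p n * (+ 2 * D))
      formula≡4p2D = trans (sym (8Dp≡formula n)) (regroup D (p n))

/-+-≃ : ∀ i j d .{{_ : NonZero d}} → toℚᵘ (i ℚ./ d ℚ.+ j ℚ./ d) ℚᵘ.≃ (i + j) ℚᵘ./ d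
/-+-≃ i j (suc d-1) = ℚᵘ.≃-trans (ℚ.toℚᵘ-homo-+ (fromℚᵘ (mkℚᵘ i d-1)) (fromℚᵘ (mkℚᵘ j d-1)))
  (ℚᵘ.≃-trans (ℚᵘ.+-cong (ℚ.toℚᵘ-fromℚᵘ (mkℚᵘ i d-1)) (ℚ.toℚᵘ-fromℚᵘ (mkℚᵘ j d-1)))
              (ℚᵘ.*≡* (common i j (+ suc d-1))))
  where
  common : ∀ i j d → (i * d + j * d) * d ≡ (i + j) * (d * d)
  common = solve-∀

/-+-≤ : ∀ i j k d .{{_ : NonZero d}} → i + j ≤ k * + d → i ℚ./ d ℚ.+ j ℚ./ d ℚ.≤ k ℚ./ 1
/-+-≤ i j k d@(suc d-1) i+j≤kd = ℚ.toℚᵘ-cancel-≤ (begin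
  toℚᵘ (i ℚ./ d ℚ.+ j ℚ./ d) ≃⟨ /-+-≃ i j d ⟩
  (i + j) ℚᵘ./ d              ≤⟨ ℚᵘ.*≤* (subst (_≤ k * + d) (sym (ℤ.*-identityʳ (i + j))) i+j≤kd) ⟩
  mkℚᵘ k 0                    ≃⟨ ℚ.toℚᵘ-fromℚᵘ (mkℚᵘ k 0) ⟨
  toℚᵘ (k ℚ./ 1)              ∎)
  where open ℚᵘ.≤-Reasoning

≤-/-+ : ∀ i j k d .{{_ : NonZero d}} → k * + d ≤ i + j → k ℚ./ 1 ℚ.≤ i ℚ./ d ℚ.+ j ℚ./ d
≤-/-+ i j k d@(suc d-1) kd≤i+j = ℚ.toℚᵘ-cancel-≤ (begin
  toℚᵘ (k ℚ./ 1)              ≃⟨ ℚ.toℚᵘ-fromℚᵘ (mkℚᵘ k 0) ⟩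
  mkℚᵘ k 0                    ≤⟨ ℚᵘ.*≤* (subst (k * + d ≤_) (sym (ℤ.*-identityʳ (i + j))) kd≤i+j) ⟩
  (i + j) ℚᵘ./ d              ≃⟨ /-+-≃ i j d ⟨
  toℚᵘ (i ℚ./ d ℚ.+ j ℚ./ d) ∎)
  where open ℚᵘ.≤-Reasoning

even-or-odd : ∀ n → ∃ λ h → n ≡ 2 ℕ.* h ⊎ n ≡ 1 ℕ.+ 2 ℕ.* h
even-or-odd zero = 0 , inj₁ refl
even-or-odd (suc n) with even-or-odd n
... | h , inj₁ refl = h , inj₂ refl
... | h , inj₂ refl = suc h , inj₁ (cong suc (sym (ℕ.+-suc h (h ℕ.+ 0))))

parametrisation : ∀ r s → Coprime r s → 2 ∣ s → 1 ℕ.≤ s → 2 ℕ.* s ℕ.< r →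
  ∃ λ m → ∃ λ x → s ≡ 2 ℕ.+ 2 ℕ.* m × r ≡ 3 ℕ.+ 2 ℕ.* m ℕ.+ 2 ℕ.* x ℕ.+ s
parametrisation r .(0 ℕ.* 2) coprime (divides zero refl) () 2s<r
parametrisation r s@.(suc m ℕ.* 2) coprime 2∣s@(divides (suc m) refl) 1≤s 2s<r with ℕ.m≤n⇒∃[o]m+o≡n 2s<r
... | t , refl = from (even-or-odd t)
  where
  even : ∀ m x → 1 ℕ.+ 2 ℕ.* (2 ℕ.+ m ℕ.* 2) ℕ.+ 2 ℕ.* x ≡ 3 ℕ.+ 2 ℕ.* m ℕ.+ 2 ℕ.* x ℕ.+ (2 ℕ.+ m ℕ.* 2)
  even = ℕ-Solver.solve-∀

  odd : ∀ s x → 1 ℕ.+ 2 ℕ.* s ℕ.+ (1 ℕ.+ 2 ℕ.* x) ≡ (1 ℕ.+ s ℕ.+ x) ℕ.* 2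
  odd = ℕ-Solver.solve-∀

  from : (∃ λ h → t ≡ 2 ℕ.* h ⊎ t ≡ 1 ℕ.+ 2 ℕ.* h) →
    ∃ λ m → ∃ λ x → s ≡ 2 ℕ.+ 2 ℕ.* m × r ≡ 3 ℕ.+ 2 ℕ.* m ℕ.+ 2 ℕ.* x ℕ.+ s
  from (x , inj₁ refl) = m , x , cong (2 ℕ.+_) (ℕ.*-comm m 2) , even m x
  from (x , inj₂ refl) with () ← coprime {2} (divides (1 ℕ.+ s ℕ.+ x) (odd s x) , 2∣s)

integral-bounds : ∀ r s → Coprime r s → 2 ∣ s → 1 ℕ.≤ s → 2 ℕ.* s ℕ.< r → ∀ {p} → IsP₃ r s p → ∀ n →
  Bounds (+ r) (+ s) (+ n) (+ (2 ℕ.* Δ₁ r s)) (p n)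
integral-bounds r s coprime 2∣s 1≤s 2s<r {p} isP₃ n = from (parametrisation r s coprime 2∣s 1≤s 2s<r)
  where
  b c : ℕ
  b = r ℕ.∸ s
  c = r ℕ.+ s

  from : (∃ λ m → ∃ λ x → s ≡ 2 ℕ.+ 2 ℕ.* m × r ≡ 3 ℕ.+ 2 ℕ.* m ℕ.+ 2 ℕ.* x ℕ.+ s) →
    Bounds (+ r) (+ s) (+ n) (+ (2 ℕ.* Δ₁ r s)) (p n)
  from (m , x , s≡ , r≡) = transport
    (coprime⇒inverse (b ℕ.+ s) s coprime-b+s) (coprime⇒inverse s b coprime-s-b) (coprime⇒inverse s c coprime-s-c)
    where
    b≡ : b ≡ 3 ℕ.+ 2 ℕ.* m ℕ.+ 2 ℕ.* x
    b≡ = trans (cong (ℕ._∸ s) r≡) (ℕ.m+n∸n≡m _ s)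

    b+s≡r : b ℕ.+ s ≡ r
    b+s≡r = trans (cong (ℕ._+ s) b≡) (sym r≡)

    c≡ : c ≡ b ℕ.+ 2 ℕ.* s
    c≡ = trans (cong (ℕ._+ s) (sym b+s≡r)) (arith b s)
      where
      arith : ∀ b s → b ℕ.+ s ℕ.+ s ≡ b ℕ.+ 2 ℕ.* s
      arith = ℕ-Solver.solve-∀

    instance
      s≢0 : NonZero s
      s≢0 = ℕ.>-nonZero 1≤s
      b≢0 : NonZero b
      b≢0 = subst NonZero (sym b≡) _
      c≢0 : NonZero c
      c≢0 = ℕ.>-nonZero (ℕ.<-≤-trans 1≤s (ℕ.m≤n+m s r))
      b+s≢0 : NonZero (b ℕ.+ s)
      b+s≢0 = ℕ.>-nonZero (ℕ.<-≤-trans 1≤s (ℕ.m≤n+m s b))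

    coprime-b+s : Coprime (b ℕ.+ s) s
    coprime-b+s = subst (λ i → Coprime i s) (sym b+s≡r) coprime

    coprime-s-b : Coprime s b
    coprime-s-b (d∣s , d∣b) = coprime-b+s (∣m∣n⇒∣m+n d∣b d∣s , d∣s)

    coprime-s-c : Coprime s c
    coprime-s-c {d} (d∣s , d∣c) = coprime-s-b
      (d∣s , ∣m+n∣m⇒∣n (subst (d ∣_) (trans c≡ (ℕ.+-comm b (2 ℕ.* s))) d∣c) (∣n⇒∣m*n 2 d∣s))

    transport :
      (∃ λ iᵃ → ∃ λ jᵃ → iᵃ ℕ.* (b ℕ.+ s) ≡ 1 ℕ.+ jᵃ ℕ.* s) →
      (∃ λ iᵇ → ∃ λ jᵇ → iᵇ ℕ.* s ≡ 1 ℕ.+ jᵇ ℕ.* b) →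
      (∃ λ iᶜ → ∃ λ jᶜ → iᶜ ℕ.* s ≡ 1 ℕ.+ jᶜ ℕ.* c) →
      Bounds (+ r) (+ s) (+ n) (+ (2 ℕ.* Δ₁ r s)) (p n)
    transport (iᵃ , jᵃ , inverseᵃ) (iᵇ , jᵇ , inverseᵇ) (iᶜ , jᶜ , inverseᶜ) =
      subst₂ (λ r′ s′ → Bounds r′ s′ (+ n) (+ (2 ℕ.* Δ₁ r s)) (p n)) B+S≡r (sym +s≡S)
        (subst (λ d → Bounds (B + S) S (+ n) d (p n)) 2D≡2Δ
          (bounds {p} (λ k → trans (sym (⊛-triple s b c p k)) (isP₃ k)) n))
      where
      open Parametrised m x s b c s≡ b≡ c≡ iᵃ jᵃ iᵇ jᵇ iᶜ jᶜ inverseᵃ inverseᵇ inverseᶜ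

      B+S≡r : B + S ≡ + r
      B+S≡r = trans (sym (cong₂ _+_ +b≡B +s≡S)) (cong +_ b+s≡r)

      2D≡2Δ : + 2 * D ≡ + (2 ℕ.* Δ₁ r s)
      2D≡2Δ = sym (trans (ℤ.pos-* 2 (Δ₁ r s)) (cong (+ 2 *_)
        (trans (ℤ.pos-* (s ℕ.* b) c) (cong₂ _*_ (trans (ℤ.pos-* s b) (cong₂ _*_ +s≡S +b≡B)) +c≡C))))

lemma4p1 : (r s : ℕ) → 1 ℕ.≤ r → Coprime r s → 2 ∣ s →
    (1≤s : 1 ℕ.≤ s) (2s<r : 2 ℕ.* s ℕ.< r) →
    (p : Series) → IsP₃ r s p → (n : ℕ) →
    let instance
          2Δ₁≢0 : NonZero (2 ℕ.* Δ₁ r s)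
          2Δ₁≢0 = 2Δ₁-nonZero 1≤s 2s<r
    in (P₂ r s n ℚ.+ Cᵈ r s ℚ.≤ p n ℚ./ 1) × (p n ℚ./ 1 ℚ.≤ P₂ r s n ℚ.+ Cᵘ r s)
lemma4p1 r s _ coprime 2∣s 1≤s 2s<r p isP₃ n = from (integral-bounds r s coprime 2∣s 1≤s 2s<r isP₃ n)
  where
  instance
    2Δ₁≢0 : NonZero (2 ℕ.* Δ₁ r s)
    2Δ₁≢0 = 2Δ₁-nonZero 1≤s 2s<r

  from : Bounds (+ r) (+ s) (+ n) (+ (2 ℕ.* Δ₁ r s)) (p n) →
         (P₂ r s n ℚ.+ Cᵈ r s ℚ.≤ p n ℚ./ 1) × (p n ℚ./ 1 ℚ.≤ P₂ r s n ℚ.+ Cᵘ r s)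
  from (lower , upper) =
    /-+-≤ (num₂ (+ r) (+ s) (+ n)) (numᵈ (+ r) (+ s)) (p n) (2 ℕ.* Δ₁ r s) lower ,
    ≤-/-+ (num₂ (+ r) (+ s) (+ n)) (numᵘ (+ r) (+ s)) (p n) (2 ℕ.* Δ₁ r s) upper
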